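{- For every integer $m\geq 0$ and every integer $r\geq 3$, $$H_{2}\left(m,\tfrac{r-1}{r-2}\right)\cdot(r-2)^{m-2}\;\leq\;\operatorname{forb}(m,r,M)-(r-1)^m-m(r-1)^{m-1}\;\leq\; H\left(m,\tfrac{r-1}{r-2}\right)\cdot(r-2)^{m-2}.$$
   Context: An $r$-matrix is a matrix with entries in $\{0,1,\dots,r-1\}$; it is simple if its columns are pairwise distinct. A matrix $A$ contains a configuration of $F$ if some submatrix of $A$ is a row and column permutation of $F$. Let $M=\begin{bmatrix}0&1\\0&1\\1&0\end{bmatrix}$, and let $\operatorname{forb}(m,r,M)$ be the maximum number of columns of an $m$-rowed simple $r$-matrix containing no configuration of $M$. A triangular choice multigraph (TCM) $\mathcal{G}$ on a vertex set $V$ is obtained by choosing, for every 3-element subset $\{u,v,w\}\subseteq V$, exactly one of the pairs $uv,uw,vw$ and adding one copy of it as an edge. For a pair $xy$, $m^{\mathcal{G}}_{xy}$ is its multiplicity (the number of triples in which $xy$ was chosen). For real $\alpha$, $w(\mathcal{G},\alpha)=\sum_{xy\in\binom{[m]}{2}}\alpha^{m^{\mathcal{G}}_{xy}}$ for a TCM on $[m]$, and $H(m,\alpha)$ is the maximum of $w(\mathcal{G},\alpha)$ over all TCMs on $[m]$. A TCM $\mathcal{G}$ on $V$ is 2-recursive if either $|V|\in\{1,2\}$ and $\mathcal{G}$ is empty, or $|V|\geq 3$ and there is a partition $V=V_1\cup V_2$ with $V_1,V_2\neq\emptyset$ such that $\mathcal{G}=\mathcal{G}_1\cup\mathcal{G}_2\cup\mathcal{G}_3$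 (union with multiplicities), where $\mathcal{G}_i$ is a 2-recursive TCM on $V_i$ ($i=1,2$) and $\mathcal{G}_3$ consists of: for every triple with $u,v\in V_1$, $w\in V_2$ a copy of $uv$, and for every triple with $u\in V_1$, $v,w\in V_2$ a copy of $vw$. $H_2(m,\alpha)$ is the maximum of $w(\mathcal{G},\alpha)$ over all 2-recursive TCMs on $[m]$ (with $H(m,\alpha)=H_2(m,\alpha)=0$ when $m\le 1$ and the empty sum convention). -}

module Defs where

open import Data.Nat as ℕ using (ℕ; zero; suc; _∸_)
open import Data.Integer using (+_)
open import Data.Rational using (ℚ; 0ℚ; 1ℚ; _/_; _+_; _*_; _-_; _≤_)
open import Data.Fin using (Fin; toℕ; _<?_; _≟_) renaming (zero to fzero; suc to fsuc)
open import Data.Fin.Subset using (Subset; _∈_; ∣_∣; Nonempty; ⊤)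
open import Data.Product using (Σ; ∃; _×_)
open import Data.Sum using (_⊎_)
open import Data.Bool using (Bool; true; false; if_then_else_; _∧_; not)
open import Relation.Nullary using (¬_; does)
open import Relation.Binary.PropositionalEquality using (_≡_)
open import Function.Bundles using (_⇔_)
open import Function.Definitions using (Injective)

infixr 8 _^ℚ_
_^ℚ_ : ℚ → ℕ → ℚ
q ^ℚ zero = 1ℚ
q ^ℚ suc n = q * (q ^ℚ n)

ℕ→ℚ : ℕ → ℚ
ℕ→ℚ n = + n / 1

sumℚ : (n : ℕ) → (Fin n → ℚ) → ℚ
sumℚ zero    f = 0ℚ
sumℚ (suc n) f = f fzero + sumℚ n (λ i → f (fsuc i))

countFin : (n : ℕ) → (Fin n → Bool) → ℕ
countFin zero    p = 0
countFin (suc n) p = (if p fzero then 1 else 0) ℕ.+ countFin n (λ i → p (fsuc i))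

Matrix : ℕ → ℕ → ℕ → Set
Matrix m n r = Fin m → Fin n → Fin r

Simple : ∀ {m n r} → Matrix m n r → Set
Simple {m} {n} A = ∀ (j k : Fin n) → (∀ (i : Fin m) → A i j ≡ A i k) → j ≡ k

M : Fin 3 → Fin 2 → ℕ
M fzero            fzero       = 0
M fzero            (fsuc _)    = 1
M (fsuc fzero)  fzero       = 0
M (fsuc fzero)  (fsuc _)    = 1
M (fsuc (fsuc _)) fzero     = 1
M (fsuc (fsuc _)) (fsuc _)  = 0

-- A contains a configuration of the p×q matrix F: some submatrix of A
-- (given by distinct rows ρ and distinct columns κ, in any order) is a
-- row and column permutation of F.
ContainsConfig : ∀ {m n r p q} → Matrix m n r → (Fin p → Fin q → ℕ) → Set
ContainsConfig {m} {n} {r} {p} {q} A F =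
  Σ (Fin p → Fin m) λ ρ → Σ (Fin q → Fin n) λ κ →
    Injective _≡_ _≡_ ρ × Injective _≡_ _≡_ κ ×
    (∀ i j → toℕ (A (ρ i) (κ j)) ≡ F i j)

IsForbM : (m r f : ℕ) → Set
IsForbM m r f =
  (Σ (Matrix m f r) λ A → Simple A × ¬ ContainsConfig A M) ×
  (∀ (n : ℕ) (A : Matrix m n r) → Simple A → ¬ ContainsConfig A M → n ℕ.≤ f)

-- Triangular choice multigraphs on Fin m.
-- A TCM is encoded by a function e giving, for each 3-set {u,v,w}, the
-- vertex e u v w ∈ {u,v,w} that is NOT in the chosen pair; e must be
-- symmetric in its arguments on pairwise distinct triples (values on
-- non-distinct triples are irrelevant).

TCMfun : ℕ → Set
TCMfun m = Fin m → Fin m → Fin m → Fin m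

IsTCM : ∀ {m} → TCMfun m → Set
IsTCM {m} e = ∀ (u v w : Fin m) → ¬ u ≡ v → ¬ u ≡ w → ¬ v ≡ w →
  ((e u v w ≡ u) ⊎ (e u v w ≡ v) ⊎ (e u v w ≡ w)) ×
  (e u v w ≡ e v u w) × (e u v w ≡ e u w v)

mult : ∀ {m} → TCMfun m → Fin m → Fin m → ℕ
mult {m} e x y = countFin m λ w →
  not (does (w ≟ x)) ∧ not (does (w ≟ y)) ∧ does (e x y w ≟ w)

weight : ∀ {m} → ℚ → TCMfun m → ℚ
weight {m} α e = sumℚ m λ x → sumℚ m λ y →
  if does (x <? y) then α ^ℚ mult e x y else 0ℚ

IsH : (m : ℕ) → ℚ → ℚ → Set
IsH m α h =
  (Σ (TCMfun m) λ e → IsTCM e × weight α e ≡ h) ×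
  (∀ (e : TCMfun m) → IsTCM e → weight α e ≤ h)

-- 2-recursive TCMs: Rec2 V e means the restriction of e to triples of
-- pairwise distinct vertices inside V is a 2-recursive TCM on V.
data Rec2 {m : ℕ} (e : TCMfun m) : Subset m → Set where
  small : ∀ {V} → ∣ V ∣ ℕ.≤ 2 → Rec2 e V
  split : ∀ {V} (V₁ V₂ : Subset m) →
    3 ℕ.≤ ∣ V ∣ →
    (∀ x → x ∈ V ⇔ (x ∈ V₁ ⊎ x ∈ V₂)) →
    (∀ x → x ∈ V₁ → ¬ x ∈ V₂) →
    Nonempty V₁ → Nonempty V₂ →
    Rec2 e V₁ → Rec2 e V₂ →
    (∀ u v w → u ∈ V₁ → v ∈ V₁ → w ∈ V₂ → ¬ u ≡ v → e u v w ≡ w) →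
    (∀ u v w → u ∈ V₁ → v ∈ V₂ → w ∈ V₂ → ¬ v ≡ w → e u v w ≡ u) →
    Rec2 e V

IsH2 : (m : ℕ) → ℚ → ℚ → Set
IsH2 m α h =
  (Σ (TCMfun m) λ e → IsTCM e × Rec2 e ⊤ × weight α e ≡ h) ×
  (∀ (e : TCMfun m) → IsTCM e → Rec2 e ⊤ → weight α e ≤ h)

-- α = (r-1)/(r-2), written with denominator suc (r ∸ 3) = r - 2 for r ≥ 3
alphaR : ℕ → ℚ
alphaR r = + (r ∸ 1) / suc (r ∸ 3)

{-# OPTIONS --safe #-}

-- Write a = r - 1 and b = r - 2.  A column is a skeleton κ, which merges the
-- entries 0 and 1 into one symbol and so lies in a set of a^m words, together
-- with the set O of ones inside the set U of rows where κ has that symbol.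
-- Both inequalities are proved separately for each κ: a family of sets O ⊆ U
-- is compared with 1 + |U| + p(U), where p(U) counts the pairs xy ⊆ U which the
-- TCM chooses in every triple xyw with w ∈ U.  Summed over κ, the three terms
-- give a^m, m a^(m-1) and Σ_xy a^(m_xy) b^(m-2-m_xy).
--
-- Upper bound.  For each triple and each w in it, at most one of the patterns
-- 001 and 110 (with w last) occurs in a matrix avoiding M.  So each vertex of a
-- triple has one of two types; the TCM omits the vertex whose type differs from
-- the other two, and the least vertex if all types agree.  Two sets O over the
-- same U are nested or differ by exchanging one element.  The bound follows by
-- induction on an X ⊆ U containing all sets of the family: either some x ∈ X lies
-- in at most one of them, or the largest proper subsets of X among them form a
-- sunflower, X - b or I + b for b ∈ B.  In that case either the two greatest
-- elements of B are a pair counted by p, or some w ∈ X lies in no set below the sunflower.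
--
-- Lower bound.  A 2-recursive TCM with parts V₁, V₂ gives the family of all
-- O₁ ∪ (U ∩ V₂) and all O₂, for O₁ and O₂ in the families of the two parts.
-- Besides the common set U ∩ V₂ they share nothing, so the sizes 1 + |U| + p(U) add
-- up, unless U has one vertex in each part, where all four subsets are allowed.
module Submission where

open import Defs

module Combinatorics where

  open import Data.Bool using (Bool; true; false; if_then_else_; _∧_; _∨_; not)
  import Data.Bool.Properties as Bool
  open import Data.Fin as Fin using (Fin; zero; suc; _<_; _<?_; toℕ)
  open import Data.Fin.Properties as F using (any?; _≟_)
  open import Data.Fin.Subset using (Subset; _∈_; _∉_; _⊆_; _-_; ∣_∣; ⊥; ⊤; ⁅_⁆; _∪_; _∩_)
  open import Data.Fin.Subset.Properties
  open import Data.List as List using (List; []; _∷_; _++_; length; filter; map; foldr; concatMap; tabulate; allFin; cartesianProduct; cartesianProductWith)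
  open import Data.List.Properties using (length-++; length-map; length-tabulate)
  import Data.List.Membership.DecPropositional as DecMembership
  import Data.List.Membership.Propositional as L
  import Data.List.Membership.Propositional.Properties as L
  open import Data.List.Relation.Unary.All as All using (All; []; _∷_)
  open import Data.List.Relation.Unary.AllPairs using ([]; _∷_)
  open import Data.List.Relation.Unary.Any as Any using (Any; here; there)
  open import Data.List.Relation.Unary.Unique.Propositional using (Unique)
  open import Data.List.Relation.Unary.Unique.Propositional.Properties as Unique using (allFin⁺)
  open import Data.Nat as ℕ using (ℕ; _+_; _*_; _^_; _∸_; _≤_; z≤n; s≤s)
  import Data.Nat.Induction as ℕ
  import Data.Nat.Properties as ℕ
  open import Data.Nat.Tactic.RingSolver using (solve-∀)
  open import Data.Product using (∃; _×_; _,_; proj₁; proj₂)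
  open import Data.Sum using (_⊎_; inj₁; inj₂)
  open import Data.Vec as Vec using (Vec; []; _∷_; lookup)
  import Data.Vec.Properties as Vec
  import Algebra.Construct.NaturalChoice.Min as Min
  open import Algebra.Properties.CommutativeSemigroup ℕ.+-commutativeSemigroup using (interchange)
  open import Algebra.Properties.CommutativeSemigroup ℕ.*-commutativeSemigroup using (x∙yz≈y∙xz)
  open import Function using (_∘_; case_of_; mk⇔; Injective)
  open import Function.Bundles using (module Equivalence)
  open import Induction.WellFounded using (Acc; acc)
  open import Relation.Binary.Definitions using (DecidableEquality)
  open import Relation.Binary.PropositionalEquality
  open import Relation.Nullary using (¬_; Dec; yes; no; does; contradiction; ¬?; _×-dec_)
  open import Relation.Nullary.Decidable using (dec-true; dec-false; decidable-stable; does-⇔)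
  open import Relation.Unary using (Decidable)

  private variable
    A B : Set
    m : ℕ

  -- Lists without repetition and greatest elements

  unique-⊆⇒length≤ : {xs ys : List A} → Unique xs →
    (∀ {x} → x L.∈ xs → x L.∈ ys) → length xs ≤ length ys
  unique-⊆⇒length≤ {xs = []} _ _ = z≤n
  unique-⊆⇒length≤ {xs = x ∷ xs} {ys} (x∉ ∷ u) sub with L.∈-∃++ (sub (here refl))
  ... | as , bs , refl = subst (ℕ.suc (length xs) ℕ.≤_) (sym eq)
          (s≤s (unique-⊆⇒length≤ u sub′))
    where
    eq : length (as ++ x ∷ bs) ≡ ℕ.suc (length (as ++ bs))
    eq = trans (length-++ as) (trans (ℕ.+-suc (length as) (length bs)) (cong ℕ.suc (sym (length-++ as))))
    sub′ : ∀ {y} → y L.∈ xs → y L.∈ as ++ bs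
    sub′ {y} y∈ with L.∈-++⁻ as (sub (there y∈))
    ... | inj₁ p = L.∈-++⁺ˡ p
    ... | inj₂ (here refl) = contradiction refl (All.lookup x∉ y∈)
    ... | inj₂ (there p) = L.∈-++⁺ʳ as p

  length-filter-split : {P : A → Set} (P? : Decidable P) (xs : List A) →
    length xs ≡ length (filter P? xs) + length (filter (¬? ∘ P?) xs)
  length-filter-split P? [] = refl
  length-filter-split P? (x ∷ xs) with P? x
  ... | yes _ = cong ℕ.suc (length-filter-split P? xs)
  ... | no _ = trans (cong ℕ.suc (length-filter-split P? xs)) (sym (ℕ.+-suc _ _))

  argmax-exists : (f : A → ℕ) {P : A → Set} (P? : Decidable P) (xs : List A) → Any P xs →
    ∃ λ x → x L.∈ xs × P x × (∀ {y} → y L.∈ xs → P y → f y ≤ f x)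
  argmax-exists f P? (x ∷ xs) any with Any.any? P? xs
  argmax-exists f P? (x ∷ xs) (here px) | no ¬any =
    x , here refl , px , λ { (here refl) _ → ℕ.≤-refl
                           ; (there y∈) py → contradiction (L.lose y∈ py) ¬any }
  argmax-exists f P? (x ∷ xs) (there any) | no ¬any = contradiction any ¬any
  argmax-exists f P? (x ∷ xs) _ | yes any with argmax-exists f P? xs any
  ... | z , z∈ , pz , max with P? x
  ...   | no ¬px = z , there z∈ , pz , λ { (here refl) py → contradiction py ¬px
                                         ; (there y∈) py → max y∈ py }
  ...   | yes px with ℕ.≤-total (f x) (f z)
  ...     | inj₁ le = z , there z∈ , pz , λ { (here refl) _ → le
                                            ; (there y∈) py → max y∈ py }
  ...     | inj₂ ge = x , here refl , px , λ { (here refl) _ → ℕ.≤-refl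
                                             ; (there y∈) py → ℕ.≤-trans (max y∈ py) ge }

  greatest : {P : Fin m → Set} → Decidable P → ∃ P → ∃ λ v → P v × (∀ w → P w → w Fin.≤ v)
  greatest {ℕ.suc m} {P} P? (x , px) with any? (P? ∘ suc)
  ... | yes p with greatest (P? ∘ suc) p
  ...   | v , pv , max = suc v , pv , λ { zero _ → z≤n ; (suc w) pw → s≤s (max w pw) }
  greatest {ℕ.suc m} {P} P? (zero , px) | no ¬p =
    zero , px , λ { zero _ → z≤n ; (suc w) pw → contradiction (w , pw) ¬p }
  greatest {ℕ.suc m} {P} P? (suc x , px) | no ¬p = contradiction (x , px) ¬p

  two-greatest : {P : Fin m → Set} → Decidable P → ∀ {x y} → P x → P y → x ≢ y →
    ∃ λ u → ∃ λ v → u < v × P u × P v × (∀ w → P w → w ≢ u → w ≢ v → w < u)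
  two-greatest {P = P} P? {x} {y} px py x≢y with greatest P? (x , px)
  ... | v , pv , vmax with greatest {P = λ w → P w × w ≢ v} (λ w → P? w ×-dec ¬? (w F.≟ v)) other
    where
    other : ∃ λ w → P w × w ≢ v
    other with x F.≟ v
    ... | no x≢v = x , px , x≢v
    ... | yes refl = y , py , x≢y ∘ sym
  ...   | u , (pu , u≢v) , umax =
    u , v , F.≤∧≢⇒< (vmax u pu) u≢v , pu , pv ,
    λ w pw w≢u w≢v → F.≤∧≢⇒< (umax w (pw , w≢v)) w≢u

  avoid-two : ∀ {P : Fin m → Set} {x y z} → P x → P y → P z → x ≢ y → x ≢ z → y ≢ z →
    ∀ u v → ∃ λ b → P b × b ≢ u × b ≢ v
  avoid-two {x = x} {y} {z} px py pz x≢y x≢z y≢z u v with x F.≟ u | x F.≟ v | y F.≟ u | y F.≟ v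
  ... | no a | no b | _ | _ = x , px , a , b
  ... | _ | _ | no a | no b = y , py , a , b
  ... | yes refl | _ | yes q | _ = contradiction (sym q) x≢y
  ... | yes refl | _ | no _ | yes refl = z , pz , x≢z ∘ sym , y≢z ∘ sym
  ... | no _ | yes refl | yes refl | _ = z , pz , y≢z ∘ sym , x≢z ∘ sym
  ... | no _ | yes refl | no _ | yes q = contradiction (sym q) x≢y

  -- Subsets with elements removed

  x∉p-x : (p : Subset m) (x : Fin m) → x ∉ p - x
  x∉p-x (_ ∷ p) zero ()
  x∉p-x (_ ∷ p) (suc x) q = x∉p-x p x (drop-there q)

  x∈p-y⇒x∈p : (p : Subset m) (y : Fin m) {x : Fin m} → x ∈ p - y → x ∈ p
  x∈p-y⇒x∈p p y = p─q⊆p p _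

  x∈p-y⇒x≢y : (p : Subset m) (y : Fin m) {x : Fin m} → x ∈ p - y → x ≢ y
  x∈p-y⇒x≢y p y x∈ refl = x∉p-x p y x∈

  _≟ₛ_ : DecidableEquality (Subset m)
  _≟ₛ_ = Vec.≡-dec Bool._≟_

  ⊆∧≢⇒⊂ : {p q : Subset m} → p ⊆ q → p ≢ q → ∃ λ x → x ∈ q × x ∉ p
  ⊆∧≢⇒⊂ {p = p} {q} p⊆q p≢q with any? (λ x → (x ∈? q) ×-dec ¬? (x ∈? p))
  ... | yes w = w
  ... | no ¬w = contradiction
    (⊆-antisym p⊆q (λ {x} x∈q → decidable-stable (x ∈? p) (λ x∉p → ¬w (x , x∈q , x∉p)))) p≢q

  infixl 5 _∖_
  _∖_ : Subset m → List (Fin m) → Subset m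
  p ∖ bs = foldr (λ b q → q - b) p bs

  ∖⊆ : (p : Subset m) (bs : List (Fin m)) → p ∖ bs ⊆ p
  ∖⊆ p [] x∈ = x∈
  ∖⊆ p (b ∷ bs) x∈ = ∖⊆ p bs (x∈p-y⇒x∈p _ b x∈)

  x∈p∖bs⇒x∉bs : (p : Subset m) (bs : List (Fin m)) {x : Fin m} → x ∈ p ∖ bs → x L.∉ bs
  x∈p∖bs⇒x∉bs p (b ∷ bs) x∈ (here refl) = x∉p-x _ b x∈
  x∈p∖bs⇒x∉bs p (b ∷ bs) x∈ (there q) = x∈p∖bs⇒x∉bs p bs (x∈p-y⇒x∈p _ b x∈) q

  x∈p∧x∉bs⇒x∈p∖bs : {p : Subset m} (bs : List (Fin m)) {x : Fin m} →
    x ∈ p → x L.∉ bs → x ∈ p ∖ bs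
  x∈p∧x∉bs⇒x∈p∖bs [] x∈ _ = x∈
  x∈p∧x∉bs⇒x∈p∖bs (b ∷ bs) x∈ x∉ =
    x∈p∧x≢y⇒x∈p-y (x∈p∧x∉bs⇒x∈p∖bs bs x∈ (x∉ ∘ there)) (x∉ ∘ here)

  length+∣∖∣≤ : (p : Subset m) {bs : List (Fin m)} → Unique bs → (∀ {b} → b L.∈ bs → b ∈ p) →
    length bs + ∣ p ∖ bs ∣ ≤ ∣ p ∣
  length+∣∖∣≤ p {[]} _ _ = ℕ.≤-refl
  length+∣∖∣≤ p {b ∷ bs} (b∉ ∷ u) sub = begin
    ℕ.suc (length bs + ∣ (p ∖ bs) - b ∣) ≡⟨ ℕ.+-suc (length bs) _ ⟨
    length bs + ℕ.suc ∣ (p ∖ bs) - b ∣   ≤⟨ ℕ.+-monoʳ-≤ (length bs) (x∈p⇒∣p-x∣<∣p∣ b∈) ⟩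
    length bs + ∣ p ∖ bs ∣                ≤⟨ length+∣∖∣≤ p u (sub ∘ there) ⟩
    ∣ p ∣ ∎
    where
    open ℕ.≤-Reasoning
    b∈ : b ∈ p ∖ bs
    b∈ = x∈p∧x∉bs⇒x∈p∖bs bs (sub (here refl)) (λ q → All.lookup b∉ q refl)

  -- h u v w = true permits the pattern 0,0,1 on the rows u,v,w (and forbids 1,1,0);
  -- h u v w = false does the opposite.  A column is given by its set O of ones
  -- among the set U of rows where its entry is 0 or 1.
  record Allowed {m} (h : Fin m → Fin m → Fin m → Bool) (U O : Subset m) : Set where
    field
      sub : O ⊆ U
      lo  : ∀ {u v w} → u ∈ U → v ∈ U → w ∈ U → u ≢ v → u ∉ O → v ∉ O → w ∈ O → h u v w ≡ true
      hi  : ∀ {u v w} → u ∈ U → v ∈ U → w ∈ U → u ≢ v → u ∈ O → v ∈ O → w ∉ O → h u v w ≡ false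
  open Allowed

  Full : ∀ {m} → (Fin m → Fin m → Fin m → Fin m) → Subset m → Fin m → Fin m → Set
  Full e U x y = ∀ w → w ∈ U → w ≢ x → w ≢ y → e x y w ≡ w

  -- The ends lie in `X`, but fullness is tested against all of `U`. In the induction over `X ⊆ U`,
  -- a pair found for a smaller `X` thus stays valid for a larger one. For `X = U` these are the
  -- pairs counted by p(U).
  FullPair : ∀ {m} → (Fin m → Fin m → Fin m → Fin m) → Subset m → Subset m → Fin m × Fin m → Set
  FullPair e U X (x , y) = x < y × x ∈ X × y ∈ X × Full e U x y

  -- Upper bound over one skeleton

  module UpperCore {m} (U : Subset m)
    (h : Fin m → Fin m → Fin m → Bool) (e : Fin m → Fin m → Fin m → Fin m)
    (e-minority : ∀ u v w → h v w u ≡ h u w v → h u v w ≢ h u w v → e u v w ≡ w)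
    (e-least : ∀ u v w → h v w u ≡ h u w v → w < u → w < v → e u v w ≡ w) where

    private
      Ok = Allowed h U

    -- If `y ≢ z`, then on the rows `y`, `z`, `x` the set `A` shows 0,0,1 and `B` shows 1,1,0, and
    -- `h` cannot permit both. Used in both directions, it says that two allowed sets are nested or
    -- differ by an exchange of one element.
    no-cross : ∀ {A B x y z} → Ok A → Ok B → x ∈ A → x ∉ B → y ∈ B → y ∉ A → z ∈ B → z ∉ A → y ≡ z
    no-cross {A} {B} {x} {y} {z} a b x∈A x∉B y∈B y∉A z∈B z∉A with y F.≟ z
    ... | yes p = p
    ... | no y≢z = case trans (sym (lo a y∈U z∈U x∈U y≢z y∉A z∉A x∈A))
                              (hi b y∈U z∈U x∈U y≢z y∈B z∈B x∉B) of λ ()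
      where
      y∈U = sub b y∈B
      z∈U = sub b z∈B
      x∈U = sub a x∈A

    -- The pairs are given as a list and not just counted, because a step that adds a pair has to
    -- see that it is new: it has an end outside the smaller set.
    Bound : Subset m → Set
    Bound X = ∀ L → Unique L → (∀ {C} → C L.∈ L → Ok C) → (∀ {C} → C L.∈ L → C ⊆ X) →
      ∃ λ Q → Unique Q × All (FullPair e U X) Q × length L ≤ 1 + ∣ X ∣ + length Q

    weaken : ∀ {X Y Q} → X ⊆ Y → All (FullPair e U X) Q → All (FullPair e U Y) Q
    weaken X⊆Y = All.map λ (lt , x∈ , y∈ , full) → lt , X⊆Y x∈ , X⊆Y y∈ , full

    full? : ∀ u v → (∃ λ w → w ∈ U × w ≢ u × w ≢ v × e u v w ≢ w) ⊎ Full e U u v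
    full? u v with any? (λ w → (w ∈? U) ×-dec ¬? (w F.≟ u) ×-dec ¬? (w F.≟ v) ×-dec ¬? (e u v w F.≟ w))
    ... | yes w = inj₁ w
    ... | no ¬w = inj₂ λ w w∈ w≢u w≢v → decidable-stable (e u v w F.≟ w) (λ ne → ¬w (w , w∈ , w≢u , w≢v , ne))

    module Step (X : Subset m) (X⊆U : X ⊆ U) (IH : ∀ Y → Y ⊆ X → ∣ Y ∣ ℕ.< ∣ X ∣ → Bound Y)
      (L : List (Subset m)) (uniq : Unique L) (ok : ∀ {C} → C L.∈ L → Ok C) (⊆X : ∀ {C} → C L.∈ L → C ⊆ X) where

      open DecMembership (_≟ₛ_ {m}) using () renaming (_∈?_ to _∈L?_)

      Goal : Set
      Goal = ∃ λ Q → Unique Q × All (FullPair e U X) Q × length L ≤ 1 + ∣ X ∣ + length Q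

      _∋?_ : (x : Fin m) → Decidable (x ∈_)
      x ∋? C = x ∈? C

      -- The members avoiding `x` lie in `X - x`. At most one member is lost on passing to them, and
      -- the size of `X` drops as well.
      remove-rare : ∀ x → x ∈ X → length (filter (x ∋?_) L) ≤ 1 → Goal
      remove-rare x x∈X few
        with IH (X - x) (x∈p-y⇒x∈p X x) (x∈p⇒∣p-x∣<∣p∣ x∈X) (filter (¬? ∘ (x ∋?_)) L)
                (Unique.filter⁺ _ uniq) (ok ∘ proj₁ ∘ L.∈-filter⁻ (¬? ∘ (x ∋?_)))
                (λ C∈ {z} z∈ → let C∈L , x∉C = L.∈-filter⁻ (¬? ∘ (x ∋?_)) C∈ in
                   x∈p∧x≢y⇒x∈p-y (⊆X C∈L z∈) (λ { refl → x∉C z∈ }))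
      ... | Q , uQ , fQ , le = Q , uQ , weaken (x∈p-y⇒x∈p X x) fQ , (begin
        length L                                                       ≡⟨ length-filter-split (x ∋?_) L ⟩
        length (filter (x ∋?_) L) + length (filter (¬? ∘ (x ∋?_)) L) ≤⟨ ℕ.+-mono-≤ few le ⟩
        1 + (1 + ∣ X - x ∣ + length Q)                                 ≤⟨ s≤s (ℕ.+-monoˡ-≤ (length Q) (x∈p⇒∣p-x∣<∣p∣ x∈X)) ⟩
        1 + ∣ X ∣ + length Q ∎)
        where open ℕ.≤-Reasoning

      module Frequent (frequent : ∀ x → x ∈ X → ¬ length (filter (x ∋?_) L) ≤ 1) where

        -- If no member but `D` contained `x`, the members through `x` would form a repetition-free
        -- list inside `D ∷ []`, against `frequent`.
        another : ∀ x → x ∈ X → ∀ D → ∃ λ C → C L.∈ L × x ∈ C × C ≢ D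
        another x x∈X D with Any.any? (λ C → (x ∈? C) ×-dec ¬? (C ≟ₛ D)) L
        ... | yes p with L.find p
        ...   | C , C∈L , x∈C , C≢D = C , C∈L , x∈C , C≢D
        another x x∈X D | no ¬p = contradiction
          (unique-⊆⇒length≤ {ys = D ∷ []} (Unique.filter⁺ (x ∋?_) uniq) only) (frequent x x∈X)
          where
          only : ∀ {C} → C L.∈ filter (x ∋?_) L → C L.∈ D ∷ []
          only {C} C∈ with C ≟ₛ D | L.∈-filter⁻ (x ∋?_) C∈
          ... | yes C≡D | _ = here C≡D
          ... | no C≢D | C∈L , x∈C = contradiction (L.lose C∈L (x∈C , C≢D)) ¬p

        module Top (A : Subset m) (A∈L : A L.∈ L) (A≢X : A ≢ X)
          (A-max : ∀ {C} → C L.∈ L → C ≢ X → ∣ C ∣ ≤ ∣ A ∣) where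

          -- B = A - y + x
          IsSwap : Fin m → Subset m → Fin m → Set
          IsSwap x B y = B L.∈ L × B ≢ X × x ∈ B × y ∈ A × y ∉ B ×
            (∀ z → z ∈ A → z ≢ y → z ∈ B) × (∀ z → z ∈ B → z ∉ A → z ≡ x)

          -- A member `B ≢ X` through `x` cannot contain all of `A`, since `A` has the largest size
          -- among such members. So `A` and `B` each have an element outside the other, and
          -- `no-cross` shrinks both differences to one element.
          swap : ∀ x → x ∈ X → x ∉ A → ∃ λ B → ∃ λ y → IsSwap x B y
          swap x x∈X x∉A with another x x∈X X
          ... | B , B∈L , x∈B , B≢X with any? (λ y → (y ∈? A) ×-dec ¬? (y ∈? B))
          ...   | no ¬y = contradiction (A-max B∈L B≢X)
                    (ℕ.<⇒≱ (p⊂q⇒∣p∣<∣q∣ ((λ {z} z∈A → decidable-stable (z ∈? B) (λ z∉B → ¬y (z , z∈A , z∉B))) , x , x∈B , x∉A)))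
          ...   | yes (y , y∈A , y∉B) = B , y , B∈L , B≢X , x∈B , y∈A , y∉B ,
                    (λ z z∈A z≢y → decidable-stable (z ∈? B)
                      (λ z∉B → z≢y (no-cross (ok B∈L) (ok A∈L) x∈B x∉A z∈A z∉B y∈A y∉B))) ,
                    (λ z z∈B z∉A → no-cross (ok A∈L) (ok B∈L) y∈A y∉B z∈B z∉A x∈B x∉A)

          -- The largest proper members are the sets X - b, for b in bs.
          module Coatoms (x : Fin m) (x∈X : x ∈ X) (x∉A : x ∉ A) (only-x : ∀ z → z ∈ X → z ∉ A → z ≡ x) where

            Blk : Fin m → Set
            Blk b = b ∈ X × (X - b) L.∈ L

            Blk? : Decidable Blk
            Blk? b = (b ∈? X) ×-dec ((X - b) ∈L? L)

            bs : List (Fin m)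
            bs = filter Blk? (allFin m)

            Blk⇒∈ : ∀ {b} → Blk b → b L.∈ bs
            Blk⇒∈ {b} = L.∈-filter⁺ Blk? (L.∈-allFin b)

            ∈⇒Blk : ∀ {b} → b L.∈ bs → Blk b
            ∈⇒Blk = proj₂ ∘ L.∈-filter⁻ Blk? {xs = allFin m}

            uniq-bs : Unique bs
            uniq-bs = Unique.filter⁺ Blk? (allFin⁺ m)

            A≡X-x : A ≡ X - x
            A≡X-x = ⊆-antisym
              (λ z∈A → x∈p∧x≢y⇒x∈p-y (⊆X A∈L z∈A) (λ { refl → x∉A z∈A }))
              (λ {z} z∈ → decidable-stable (z ∈? A) (λ z∉A →
                x∈p-y⇒x≢y X x z∈ (only-x z (x∈p-y⇒x∈p X x z∈) z∉A)))

            Blk-x : Blk x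
            Blk-x = x∈X , subst (L._∈ L) A≡X-x A∈L

            -- Exchanging some `y` of `A = X - x` for `x` yields `X - y`. This provides the two
            -- distinct blocks that `two-greatest` asks for.
            Blk-other : ∃ λ y → Blk y × x ≢ y
            Blk-other with swap x x∈X x∉A
            ... | B , y , B∈L , B≢X , x∈B , y∈A , y∉B , A-y⊆B , B⊆A+x =
              y , (⊆X A∈L y∈A , subst (L._∈ L) B≡X-y B∈L) , λ { refl → x∉A y∈A }
              where
              B≡X-y : B ≡ X - y
              B≡X-y = ⊆-antisym
                (λ z∈B → x∈p∧x≢y⇒x∈p-y (⊆X B∈L z∈B) (λ { refl → y∉B z∈B }))
                λ {z} z∈ → case z ∈? A of λ
                  { (yes z∈A) → A-y⊆B z z∈A (x∈p-y⇒x≢y X y z∈)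
                  ; (no z∉A) → subst (_∈ B) (sym (only-x z (x∈p-y⇒x∈p X y z∈) z∉A)) x∈B }

            X′ : Subset m
            X′ = X ∖ bs

            low? : Decidable (_⊆ X′)
            low? C = C ⊆? X′

            L′ : List (Subset m)
            L′ = filter low? L

            -- `C` contains some `b` for which `X - b` is a member. As `b` lies in `C` and not in
            -- `X - b`, `no-cross` leaves at most one element of `X - b` outside `C`. So `C` lacks a
            -- single element of `X` and is itself of the form `X - c`.
            high-member : ∀ {C} → C L.∈ filter (¬? ∘ low?) L → C ≢ X → C L.∈ map (X -_) bs
            high-member {C} C∈ C≢X with L.∈-filter⁻ (¬? ∘ low?) {xs = L} C∈
            ... | C∈L , C⊈X′ with any? (λ b → (b ∈? C) ×-dec Any.any? (b F.≟_) bs)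
            ...   | no none = contradiction
                      (λ {z} z∈C → x∈p∧x∉bs⇒x∈p∖bs bs (⊆X C∈L z∈C) (λ z∈bs → none (z , z∈C , z∈bs))) C⊈X′
            ...   | yes (b , b∈C , b∈bs) with ⊆∧≢⇒⊂ (⊆X C∈L) C≢X
            ...     | c , c∈X , c∉C = subst (L._∈ map (X -_) bs) (sym C≡X-c)
                        (L.∈-map⁺ (X -_) (Blk⇒∈ (c∈X , subst (L._∈ L) C≡X-c C∈L)))
              where
              X-b∈L = proj₂ (∈⇒Blk b∈bs)
              C≡X-c : C ≡ X - c
              C≡X-c = ⊆-antisym
                (λ z∈C → x∈p∧x≢y⇒x∈p-y (⊆X C∈L z∈C) (λ { refl → c∉C z∈C }))
                λ {z} z∈ → decidable-stable (z ∈? C) λ z∉C → x∈p-y⇒x≢y X c z∈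
                  (no-cross (ok C∈L) (ok X-b∈L) b∈C (x∉p-x X b)
                    (x∈p∧x≢y⇒x∈p-y (x∈p-y⇒x∈p X c z∈) (λ { refl → z∉C b∈C })) z∉C
                    (x∈p∧x≢y⇒x∈p-y c∈X (λ { refl → c∉C b∈C })) c∉C)

            high-count : length (filter (¬? ∘ low?) L) ≤ 1 + length bs
            high-count = ℕ.≤-trans
              (unique-⊆⇒length≤ {ys = X ∷ map (X -_) bs} (Unique.filter⁺ _ uniq) λ {C} C∈ →
                case C ≟ₛ X of λ { (yes eq) → here eq ; (no ne) → there (high-member C∈ ne) })
              (s≤s (ℕ.≤-reflexive (length-map (X -_) bs)))

            high-count-X∉L : X L.∉ L → length (filter (¬? ∘ low?) L) ≤ length bs
            high-count-X∉L X∉L = ℕ.≤-trans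
              (unique-⊆⇒length≤ {ys = map (X -_) bs} (Unique.filter⁺ _ uniq) λ {C} C∈ →
                high-member C∈ λ { refl → X∉L (proj₁ (L.∈-filter⁻ (¬? ∘ low?) {xs = L} C∈)) })
              (ℕ.≤-reflexive (length-map (X -_) bs))

            ∣X∣-split : length bs + ∣ X′ ∣ ≤ ∣ X ∣
            ∣X∣-split = length+∣∖∣≤ X uniq-bs (proj₁ ∘ ∈⇒Blk)

            ∣X′∣<∣X∣ : ∣ X′ ∣ ℕ.< ∣ X ∣
            ∣X′∣<∣X∣ = ℕ.≤-trans (ℕ.+-monoˡ-≤ ∣ X′ ∣ (L.∈-length (Blk⇒∈ Blk-x))) ∣X∣-split

            -- `Y` is kept variable because `goal-skip` takes it smaller than `X′` by one element.
            low-bound : ∀ Y → Y ⊆ X′ → (∀ {C} → C L.∈ L′ → C ⊆ Y) →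
              ∃ λ Q → Unique Q × All (FullPair e U Y) Q × length L′ ≤ 1 + ∣ Y ∣ + length Q
            low-bound Y Y⊆X′ sub′ = IH Y (∖⊆ X bs ∘ Y⊆X′) (ℕ.≤-<-trans (p⊆q⇒∣p∣≤∣q∣ Y⊆X′) ∣X′∣<∣X∣)
              L′ (Unique.filter⁺ low? uniq) (ok ∘ proj₁ ∘ L.∈-filter⁻ low?) sub′

            L′⊆X′ : ∀ {C} → C L.∈ L′ → C ⊆ X′
            L′⊆X′ C∈ = proj₂ (L.∈-filter⁻ low? {xs = L} C∈)

            open ℕ.≤-Reasoning

            total : ∀ {d k q} → length (filter (¬? ∘ low?) L) ≤ d → length L′ ≤ 1 + k + q →
              length L ≤ 1 + (d + k) + q
            total {d} {k} {q} dh dl = begin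
              length L                                          ≡⟨ length-filter-split low? L ⟩
              length L′ + length (filter (¬? ∘ low?) L)         ≤⟨ ℕ.+-mono-≤ dl dh ⟩
              1 + k + q + d                                     ≡⟨ ℕ.+-comm _ d ⟩
              d + (1 + (k + q))                                 ≡⟨ ℕ.+-suc d _ ⟩
              1 + (d + (k + q))                                 ≡⟨ cong ℕ.suc (ℕ.+-assoc d k q) ⟨
              1 + (d + k) + q ∎

            -- Without `X` itself there are at most `length bs` high members, and the size drops by
            -- at least that much from `X` to `X′`.
            goal-X∉L : X L.∉ L → Goal
            goal-X∉L X∉L with low-bound X′ (λ z → z) L′⊆X′
            ... | Q , uQ , fQ , le = Q , uQ , weaken (∖⊆ X bs) fQ ,
              ℕ.≤-trans (total (high-count-X∉L X∉L) le) (s≤s (ℕ.+-monoˡ-≤ (length Q) ∣X∣-split))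

            -- The member `X` makes one high member too many, and the pair `(u , v)` pays for it.
            -- The pair is new because both ends of every pair in `Q` lie in `X′`, which omits `u`.
            goal-full : ∀ u v → Blk u → Blk v → u < v → Full e U u v → Goal
            goal-full u v bu bv u<v full with low-bound X′ (λ z → z) L′⊆X′
            ... | Q , uQ , fQ , le = (u , v) ∷ Q ,
              All.tabulate (λ { {.(u , v)} q refl → x∈p∖bs⇒x∉bs X bs (proj₁ (proj₂ (All.lookup fQ q))) (Blk⇒∈ bu) }) ∷ uQ ,
              (u<v , proj₁ bu , proj₁ bv , full) ∷ weaken (∖⊆ X bs) fQ , (begin
              length L                                    ≤⟨ total high-count le ⟩
              1 + (1 + (length bs + ∣ X′ ∣)) + length Q   ≤⟨ s≤s (s≤s (ℕ.+-monoˡ-≤ (length Q) ∣X∣-split)) ⟩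
              1 + (1 + (∣ X ∣ + length Q))                ≡⟨ cong ℕ.suc (ℕ.+-suc ∣ X ∣ (length Q)) ⟨
              1 + ∣ X ∣ + length ((u , v) ∷ Q) ∎)

            -- Here the surplus member `X` is paid for by `w`: the low members fit into `X′ - w`.
            goal-skip : ∀ w → w ∈ X′ → (∀ {C} → C L.∈ L′ → w ∉ C) → Goal
            goal-skip w w∈X′ w∉ with low-bound (X′ - w) (x∈p-y⇒x∈p X′ w)
                (λ C∈ {z} z∈ → x∈p∧x≢y⇒x∈p-y (L′⊆X′ C∈ z∈) (λ { refl → w∉ C∈ z∈ }))
            ... | Q , uQ , fQ , le = Q , uQ , weaken (∖⊆ X bs ∘ x∈p-y⇒x∈p X′ w) fQ , (begin
              length L                                    ≤⟨ total high-count le ⟩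
              1 + (1 + (length bs + ∣ X′ - w ∣)) + length Q ≡⟨ cong (λ k → 1 + k + length Q) (ℕ.+-suc (length bs) _) ⟨
              1 + (length bs + (1 + ∣ X′ - w ∣)) + length Q ≤⟨ s≤s (ℕ.+-monoˡ-≤ (length Q) (ℕ.+-monoʳ-≤ (length bs) (x∈p⇒∣p-x∣<∣p∣ w∈X′))) ⟩
              1 + (length bs + ∣ X′ ∣) + length Q         ≤⟨ s≤s (ℕ.+-monoˡ-≤ (length Q) ∣X∣-split) ⟩
              1 + ∣ X ∣ + length Q ∎)

            -- If the two greatest blocks `u`, `v` do not form a full pair, some `w` violates
            -- fullness. The sets `X`, `X - u`, `X - v` rule out every position of `w` except one
            -- that suits `goal-skip`.
            goal-X∈L : X L.∈ L → Goal
            goal-X∈L X∈L with two-greatest Blk? Blk-x (proj₁ (proj₂ Blk-other)) (proj₂ (proj₂ Blk-other))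
            ... | u , v , u<v , bu@(u∈X , X-u∈L) , bv@(v∈X , X-v∈L) , below with full? u v
            ...   | inj₂ full = goal-full u v bu bv u<v full
            ...   | inj₁ (w , w∈U , w≢u , w≢v , e≢w) = case w ∈? X of λ { (no w∉X) → outside w∉X ; (yes w∈X) → inside w∈X }
              where
              u≢v : u ≢ v
              u≢v = F.<⇒≢ u<v
              u∈U = X⊆U u∈X
              v∈U = X⊆U v∈X
              u∈X-v = x∈p∧x≢y⇒x∈p-y u∈X u≢v
              v∈X-u = x∈p∧x≢y⇒x∈p-y v∈X (u≢v ∘ sym)

              -- With `w` zero throughout, `X - v` and `X - u` show 0,0,1 ending in `u` and in `v`,
              -- while `X` shows 1,1,0 ending in `w`. So `w` alone has type `false` and would be
              -- omitted.
              outside : w ∉ X → Goal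
              outside w∉X = contradiction
                (e-minority u v w (trans vwu (sym uwv)) λ eq → case trans (sym uvw) (trans eq uwv) of λ ()) e≢w
                where
                vwu : h v w u ≡ true
                vwu = lo (ok X-v∈L) v∈U w∈U u∈U (w≢v ∘ sym) (x∉p-x X v) (w∉X ∘ x∈p-y⇒x∈p X v) u∈X-v
                uwv : h u w v ≡ true
                uwv = lo (ok X-u∈L) u∈U w∈U v∈U (w≢u ∘ sym) (x∉p-x X u) (w∉X ∘ x∈p-y⇒x∈p X u) v∈X-u
                uvw : h u v w ≡ false
                uvw = hi (ok X∈L) u∈U v∈U w∈U u≢v u∈X v∈X w∉X

              -- Now `X - u` and `X - v` show 1,1,0, so `u` and `v` both have type `false`. If `w`
              -- is a block too, the choice of `u` and `v` makes it the least of the three, and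
              -- `e-least` would omit it.
              inside : w ∈ X → Goal
              inside w∈X = case Blk? w of λ
                { (yes bw) → contradiction (e-least u v w agree (below w bw w≢u w≢v) (F.<-trans (below w bw w≢u w≢v) u<v)) e≢w
                ; (no ¬bw) → goal-skip w (x∈p∧x∉bs⇒x∈p∖bs bs w∈X (¬bw ∘ ∈⇒Blk)) skip }
                where
                uwv : h u w v ≡ false
                uwv = hi (ok X-v∈L) u∈U w∈U v∈U (w≢u ∘ sym) u∈X-v (x∈p∧x≢y⇒x∈p-y w∈X w≢v) (x∉p-x X v)
                vwu : h v w u ≡ false
                vwu = hi (ok X-u∈L) v∈U w∈U u∈U (w≢v ∘ sym) v∈X-u (x∈p∧x≢y⇒x∈p-y w∈X w≢u) (x∉p-x X u)
                agree : h v w u ≡ h u w v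
                agree = trans vwu (sym uwv)
                -- A low member through `w` omits the blocks `u` and `v`, hence shows 0,0,1 ending
                -- in `w` and would make `w` the odd vertex.
                skip : ∀ {C} → C L.∈ L′ → w ∉ C
                skip C∈ w∈C = e≢w (e-minority u v w agree λ eq → case trans (sym uvw) (trans eq uwv) of λ ())
                  where
                  gone : ∀ {b} → Blk b → b ∉ _
                  gone bb b∈C = x∈p∖bs⇒x∉bs X bs (L′⊆X′ C∈ b∈C) (Blk⇒∈ bb)
                  uvw : h u v w ≡ true
                  uvw = lo (ok (proj₁ (L.∈-filter⁻ low? C∈))) u∈U v∈U w∈U u≢v (gone bu) (gone bv) w∈C

            goal : Goal
            goal = case X ∈L? L of λ { (yes X∈L) → goal-X∈L X∈L ; (no X∉L) → goal-X∉L X∉L }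

          -- The largest proper members are the sets I + b, where I = A - y and b ranges over X \ I.
          module Petals (x x′ : Fin m) (x∈X : x ∈ X) (x∉A : x ∉ A) (x′∈X : x′ ∈ X) (x′∉A : x′ ∉ A) (x≢x′ : x ≢ x′)
            (B : Subset m) (y : Fin m) (is-swap : IsSwap x B y) where

            y∈A : y ∈ A
            y∈A = let _ , _ , _ , y∈A , _ = is-swap in y∈A

            InI : Fin m → Set
            InI z = z ∈ A × z ≢ y

            Rim : Fin m → Set
            Rim b = b ∈ X × ¬ InI b

            Rim? : Decidable Rim
            Rim? b = (b ∈? X) ×-dec ¬? ((b ∈? A) ×-dec ¬? (b F.≟ y))

            IsPetal : Fin m → Subset m → Set
            IsPetal b P = P L.∈ L × P ≢ X × b ∈ P × (∀ z → InI z → z ∈ P) × (∀ z → z ∈ P → ¬ InI z → z ≡ b)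

            ∉A⇒¬InI : ∀ {z} → z ∉ A → ¬ InI z
            ∉A⇒¬InI z∉A (z∈A , _) = z∉A z∈A

            Rim-y : Rim y
            Rim-y = ⊆X A∈L y∈A , λ (_ , ne) → ne refl

            from-swap : ∀ {b B} → B L.∈ L → B ≢ X → b ∈ B → y ∉ B →
              (∀ z → z ∈ A → z ≢ y → z ∈ B) → (∀ z → z ∈ B → z ∉ A → z ≡ b) → IsPetal b B
            from-swap {b} {B} B∈L B≢X b∈B y∉B A-y⊆B B⊆A+b = B∈L , B≢X , b∈B , (λ z (z∈A , z≢y) → A-y⊆B z z∈A z≢y) ,
              λ z z∈B ¬I → B⊆A+b z z∈B λ z∈A → ¬I (z∈A , λ { refl → y∉B z∈B })

            -- `A` is the petal of `y`, `B` is that of `x`, and `swap` supplies the others.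
            petal : ∀ b → Rim b → ∃ (IsPetal b)
            petal b (b∈X , ¬I) with b ∈? A
            ... | yes b∈A = A , A∈L , A≢X , b∈A , (λ z → proj₁) , λ z z∈A ¬Iz →
                    trans (stable-y z∈A ¬Iz) (sym (stable-y b∈A ¬I))
              where
              stable-y : ∀ {z} → z ∈ A → ¬ InI z → z ≡ y
              stable-y {z} z∈A ¬Iz = decidable-stable (z F.≟ y) (λ z≢y → ¬Iz (z∈A , z≢y))
            ... | no b∉A with b F.≟ x
            ...   | yes refl = let B∈L , B≢X , x∈B , _ , y∉B , A-y⊆B , B⊆A+x = is-swap in
                    B , from-swap B∈L B≢X x∈B y∉B A-y⊆B B⊆A+x
            ...   | no b≢x with swap b b∈X b∉A
            ...     | B′ , y′ , B′∈L , B′≢X , b∈B′ , y′∈A , y′∉B′ , A-y′⊆B′ , B′⊆A+b =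
                    B′ , from-swap B′∈L B′≢X b∈B′ (subst (_∉ B′) (sym y≡y′) y′∉B′)
                           (λ z z∈A z≢y → A-y′⊆B′ z z∈A (λ z≡y′ → z≢y (trans z≡y′ (sym y≡y′)))) B′⊆A+b
              where
              -- All exchanges give up the same element of `A`. Otherwise `B′` contains `y`, which
              -- `B` lacks, and `B` contains `x` and `y′`, which `B′` lacks. Then `no-cross` equates
              -- `x`, outside `A`, with `y′`, inside `A`.
              y≡y′ : y ≡ y′
              y≡y′ with y F.≟ y′
              ... | yes p = p
              ... | no y≢y′ = let B∈L , B≢X , x∈B , y∈A , y∉B , A-y⊆B , _ = is-swap in contradiction
                    (subst (_∈ A) (sym (no-cross (ok B′∈L) (ok B∈L) (A-y′⊆B′ _ y∈A y≢y′) y∉B x∈B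
                        (λ x∈B′ → b≢x (sym (B′⊆A+b x x∈B′ x∉A)))
                        (A-y⊆B y′ y′∈A (y≢y′ ∘ sym)) y′∉B′)) y′∈A) x∉A

            Rim-x : Rim x
            Rim-x = x∈X , ∉A⇒¬InI x∉A

            Rim-x′ : Rim x′
            Rim-x′ = x′∈X , ∉A⇒¬InI x′∉A

            -- A missing element would have to lie in `A`, as all elements of `X` outside `A` are in
            -- the rim. But `C` has two elements `x`, `x′` outside `A`, so `no-cross` lets nothing
            -- of `A` be missing.
            contains-rim⇒X : ∀ {C} → C L.∈ L → (∀ b → Rim b → b ∈ C) → C ≡ X
            contains-rim⇒X {C} C∈L all = ⊆-antisym (⊆X C∈L) λ {z} z∈X → decidable-stable (z ∈? C) λ z∉C →
              x≢x′ (no-cross (ok A∈L) (ok C∈L)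
                (decidable-stable (z ∈? A) (λ z∉A → z∉C (all z (z∈X , ∉A⇒¬InI z∉A)))) z∉C
                (all x Rim-x) x∉A (all x′ Rim-x′) x′∉A)

            -- `C` misses some rim element `c`; let `D` be its petal. Since `c` lies only in `D` and
            -- `b` only in `C`, `no-cross` works both ways: `b` is the only rim element of `C`, and
            -- `C` contains all of I.
            petal-unique : ∀ {b P C} → Rim b → IsPetal b P → C L.∈ L → C ≢ X → b ∈ C → C ≡ P
            petal-unique {b} {P} {C} rb (P∈L , _ , b∈P , I⊆P , P⊆I+b) C∈L C≢X b∈C
              with any? (λ c → Rim? c ×-dec ¬? (c ∈? C))
            ... | no none = contradiction
                  (contains-rim⇒X C∈L λ c rc → decidable-stable (c ∈? C) λ c∉C → none (c , rc , c∉C)) C≢X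
            ... | yes (c , rc , c∉C) with petal c rc
            ...   | D , D∈L , _ , c∈D , I⊆D , D⊆I+c = ⊆-antisym
                    (λ {z} z∈C → case InI? z of λ { (yes i) → I⊆P z i ; (no ¬i) → subst (_∈ P) (sym (C⊆I+b z z∈C ¬i)) b∈P })
                    (λ {z} z∈P → case InI? z of λ { (yes i) → I⊆C z i ; (no ¬i) → subst (_∈ C) (sym (P⊆I+b z z∈P ¬i)) b∈C })
              where
              InI? : Decidable InI
              InI? z = (z ∈? A) ×-dec ¬? (z F.≟ y)
              ∉D : ∀ {z} → z ∈ C → ¬ InI z → z ∉ D
              ∉D {z} z∈C ¬i z∈D = c∉C (subst (_∈ C) (D⊆I+c z z∈D ¬i) z∈C)
              C⊆I+b : ∀ z → z ∈ C → ¬ InI z → z ≡ b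
              C⊆I+b z z∈C ¬i = no-cross (ok D∈L) (ok C∈L) c∈D c∉C z∈C (∉D z∈C ¬i) b∈C (∉D b∈C (proj₂ rb))
              I⊆C : ∀ z → InI z → z ∈ C
              I⊆C z i = decidable-stable (z ∈? C) λ z∉C → proj₂ rc (subst InI
                (no-cross (ok C∈L) (ok D∈L) b∈C (∉D b∈C (proj₂ rb)) (I⊆D z i) z∉C c∈D c∉C) i)

            -- Only `X` and the petal of `v` contain `v`. Passing to `X - v` thus loses at most two
            -- members but only one element, and the pair `(u , v)` makes up the difference.
            goal : Goal
            goal with two-greatest Rim? Rim-x Rim-x′ x≢x′
            ... | u , v , u<v , ru@(u∈X , ¬Iu) , rv@(v∈X , ¬Iv) , below
              with petal u ru | petal v rv
                 -- The rim has at least the three elements `x`, `x′`, `y`, so one is left besides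
                 -- `u` and `v`. Its petal decides the type of the rows `w` in I.
                 | avoid-two {P = Rim} Rim-x Rim-x′ Rim-y x≢x′ (λ { refl → x∉A y∈A }) (λ { refl → x′∉A y∈A }) u v
            ... | Pu , pu@(Pu∈L , _ , u∈Pu , I⊆Pu , Pu⊆I+u) | Pv , pv@(Pv∈L , _ , v∈Pv , I⊆Pv , Pv⊆I+v)
                | b , rb , b≢u , b≢v with petal b rb
            ...   | Pb , Pb∈L , _ , b∈Pb , I⊆Pb , Pb⊆I+b
              with IH (X - v) (x∈p-y⇒x∈p X v) (x∈p⇒∣p-x∣<∣p∣ v∈X) (filter (¬? ∘ (v ∋?_)) L)
                   (Unique.filter⁺ _ uniq) (ok ∘ proj₁ ∘ L.∈-filter⁻ (¬? ∘ (v ∋?_)))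
                   (λ C∈ {z} z∈ → let C∈L , v∉C = L.∈-filter⁻ (¬? ∘ (v ∋?_)) C∈ in
                      x∈p∧x≢y⇒x∈p-y (⊆X C∈L z∈) (λ { refl → v∉C z∈ }))
            ...     | Q , uQ , fQ , le = (u , v) ∷ Q ,
              All.tabulate (λ { {.(u , v)} q refl → x∉p-x X v (proj₁ (proj₂ (proj₂ (All.lookup fQ q)))) }) ∷ uQ ,
              (u<v , u∈X , v∈X , full) ∷ weaken (x∈p-y⇒x∈p X v) fQ , (begin
              length L                                                       ≡⟨ length-filter-split (v ∋?_) L ⟩
              length (filter (v ∋?_) L) + length (filter (¬? ∘ (v ∋?_)) L) ≤⟨ ℕ.+-mono-≤ few le ⟩
              2 + (1 + ∣ X - v ∣ + length Q)                                 ≤⟨ s≤s (s≤s (ℕ.+-monoˡ-≤ (length Q) (x∈p⇒∣p-x∣<∣p∣ v∈X))) ⟩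
              1 + (1 + (∣ X ∣ + length Q))                                   ≡⟨ cong ℕ.suc (ℕ.+-suc ∣ X ∣ (length Q)) ⟨
              1 + ∣ X ∣ + length ((u , v) ∷ Q) ∎)
              where
              open ℕ.≤-Reasoning
              u≢v : u ≢ v
              u≢v = F.<⇒≢ u<v
              u∈U = X⊆U u∈X
              v∈U = X⊆U v∈X

              few : length (filter (v ∋?_) L) ≤ 2
              few = unique-⊆⇒length≤ {ys = X ∷ Pv ∷ []} (Unique.filter⁺ _ uniq) λ {C} C∈ →
                let C∈L , v∈C = L.∈-filter⁻ (v ∋?_) C∈ in
                case C ≟ₛ X of λ { (yes eq) → here eq ; (no ne) → there (here (petal-unique rv pv C∈L ne v∈C)) }

              -- By `another`, `v` lies in a member other than its petal, and by uniqueness this can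
              -- only be `X`.
              X∈L : X L.∈ L
              X∈L with another v v∈X Pv
              ... | C , C∈L , v∈C , C≢Pv with C ≟ₛ X
              ...   | yes eq = subst (L._∈ L) eq C∈L
              ...   | no ne = contradiction (petal-unique rv pv C∈L ne v∈C) C≢Pv

              v∉Pu : v ∉ Pu
              v∉Pu v∈ = u≢v (sym (Pu⊆I+u v v∈ ¬Iv))
              u∉Pv : u ∉ Pv
              u∉Pv u∈ = u≢v (Pv⊆I+v u u∈ ¬Iu)

              -- For `w` outside `X` or on the rim, the petals of `u` and `v` give both these
              -- vertices type `true`; either `X` then gives `w` type `false`, or `w` is the least.
              -- For `w` in I they give type `false`, and the petal of `b` gives `w` type `true`.
              full : Full e U u v
              full w w∈U w≢u w≢v with w ∈? X
              ... | no w∉X = e-minority u v w (trans vwu (sym uwv)) λ eq → case trans (sym uvw) (trans eq uwv) of λ ()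
                where
                vwu : h v w u ≡ true
                vwu = lo (ok Pu∈L) v∈U w∈U u∈U (w≢v ∘ sym) v∉Pu (w∉X ∘ ⊆X Pu∈L) u∈Pu
                uwv : h u w v ≡ true
                uwv = lo (ok Pv∈L) u∈U w∈U v∈U (w≢u ∘ sym) u∉Pv (w∉X ∘ ⊆X Pv∈L) v∈Pv
                uvw : h u v w ≡ false
                uvw = hi (ok X∈L) u∈U v∈U w∈U u≢v u∈X v∈X w∉X
              ... | yes w∈X with Rim? w
              ...   | yes rw = e-least u v w (trans vwu (sym uwv)) w<u (F.<-trans w<u u<v)
                where
                w<u = below w rw w≢u w≢v
                vwu : h v w u ≡ true
                vwu = lo (ok Pu∈L) v∈U w∈U u∈U (w≢v ∘ sym) v∉Pu (λ w∈ → w≢u (Pu⊆I+u w w∈ (proj₂ rw))) u∈Pu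
                uwv : h u w v ≡ true
                uwv = lo (ok Pv∈L) u∈U w∈U v∈U (w≢u ∘ sym) u∉Pv (λ w∈ → w≢v (Pv⊆I+v w w∈ (proj₂ rw))) v∈Pv
              ...   | no ¬rw = e-minority u v w (trans vwu (sym uwv)) λ eq → case trans (sym uvw) (trans eq uwv) of λ ()
                where
                iw : InI w
                iw = decidable-stable ((w ∈? A) ×-dec ¬? (w F.≟ y)) (λ ¬i → ¬rw (w∈X , ¬i))
                uwv : h u w v ≡ false
                uwv = hi (ok Pu∈L) u∈U w∈U v∈U (w≢u ∘ sym) u∈Pu (I⊆Pu w iw) v∉Pu
                vwu : h v w u ≡ false
                vwu = hi (ok Pv∈L) v∈U w∈U u∈U (w≢v ∘ sym) v∈Pv (I⊆Pv w iw) u∉Pv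
                uvw : h u v w ≡ true
                uvw = lo (ok Pb∈L) u∈U v∈U w∈U u≢v
                  (λ u∈ → b≢u (sym (Pb⊆I+b u u∈ ¬Iu))) (λ v∈ → b≢v (sym (Pb⊆I+b v v∈ ¬Iv))) (I⊆Pb w iw)

          goal : Goal
          goal with ⊆∧≢⇒⊂ (⊆X A∈L) A≢X
          ... | x , x∈X , x∉A with any? (λ x′ → (x′ ∈? X) ×-dec ¬? (x′ ∈? A) ×-dec ¬? (x F.≟ x′))
          ...   | yes (x′ , x′∈X , x′∉A , x≢x′) with swap x x∈X x∉A
          ...     | B , y , is-swap = Petals.goal x x′ x∈X x∉A x′∈X x′∉A x≢x′ B y is-swap
          goal | x , x∈X , x∉A | no none = Coatoms.goal x x∈X x∉A λ z z∈X z∉A → decidable-stable (z F.≟ x) λ z≢x →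
                    none (z , z∈X , z∉A , z≢x ∘ sym)

      goal : Goal
      goal with any? (λ x → (x ∈? X) ×-dec (length (filter (x ∋?_) L) ℕ.≤? 1))
      ... | yes (x , x∈X , few) = remove-rare x x∈X few
      ... | no none with nonempty? X
      ...   | no empty = [] , [] , [] , ℕ.≤-trans
                (unique-⊆⇒length≤ {ys = ⊥ ∷ []} uniq λ C∈L → here (Empty-unique λ (z , z∈C) → empty (z , ⊆X C∈L z∈C)))
                (s≤s z≤n)
      ...   | yes (x , x∈X) = Top.goal T T∈L T≢X T-max
        where
        open Frequent (λ x x∈X few → none (x , x∈X , few))
        -- No element is rare, so `x` lies in a member other than `X`, and a largest such member
        -- exists.
        proper : Any (_≢ X) L
        proper = let _ , C∈L , _ , C≢X = another x x∈X X in L.lose C∈L C≢X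
        top = argmax-exists ∣_∣ (λ C → ¬? (C ≟ₛ X)) L proper
        T = proj₁ top
        T∈L = proj₁ (proj₂ top)
        T≢X = proj₁ (proj₂ (proj₂ top))
        T-max : ∀ {C} → C L.∈ L → C ≢ X → ∣ C ∣ ≤ ∣ T ∣
        T-max = proj₂ (proj₂ (proj₂ top))

    bound-acc : ∀ X → X ⊆ U → Acc ℕ._<_ ∣ X ∣ → Bound X
    bound-acc X X⊆U (acc rs) = Step.goal X X⊆U λ Y Y⊆X lt → bound-acc Y (X⊆U ∘ Y⊆X) (rs lt)

    bound : Bound U
    bound = bound-acc U (λ z → z) (ℕ.<-wellFounded ∣ U ∣)

  -- Families of sets from a 2-recursive TCM

  unique-map⁺ : (f : A → B) {xs : List A} →
    (∀ {x y} → x L.∈ xs → y L.∈ xs → f x ≡ f y → x ≡ y) → Unique xs → Unique (map f xs)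
  unique-map⁺ f inj [] = []
  unique-map⁺ f {x ∷ xs} inj (x∉ ∷ u) =
    All.tabulate fresh ∷ unique-map⁺ f (λ p q → inj (there p) (there q)) u
    where
    fresh : ∀ {z} → z L.∈ map f xs → f x ≢ z
    fresh z∈ fx≡z with L.∈-map⁻ f z∈
    ... | y , y∈ , z≡fy = All.lookup x∉ y∈ (inj (here refl) (there y∈) (trans fx≡z z≡fy))

  ∣p∪q∣≤∣p∣+∣q∣ : ∀ {m} (p q : Subset m) → ∣ p ∪ q ∣ ≤ ∣ p ∣ + ∣ q ∣
  ∣p∪q∣≤∣p∣+∣q∣ [] [] = z≤n
  ∣p∪q∣≤∣p∣+∣q∣ (false ∷ p) (false ∷ q) = ∣p∪q∣≤∣p∣+∣q∣ p q
  ∣p∪q∣≤∣p∣+∣q∣ (false ∷ p) (true ∷ q) = ℕ.≤-trans (s≤s (∣p∪q∣≤∣p∣+∣q∣ p q)) (ℕ.≤-reflexive (sym (ℕ.+-suc ∣ p ∣ ∣ q ∣)))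
  ∣p∪q∣≤∣p∣+∣q∣ (true ∷ p) (false ∷ q) = s≤s (∣p∪q∣≤∣p∣+∣q∣ p q)
  ∣p∪q∣≤∣p∣+∣q∣ (true ∷ p) (true ∷ q) = s≤s (ℕ.≤-trans (∣p∪q∣≤∣p∣+∣q∣ p q) (ℕ.+-monoʳ-≤ ∣ p ∣ (ℕ.n≤1+n ∣ q ∣)))

  ≤2⇒no-three : ∀ {m} {X : Subset m} → ∣ X ∣ ≤ 2 → ∀ {u v w} → u ∈ X → v ∈ X → w ∈ X →
    u ≢ v → u ≢ w → v ≢ w → {A : Set} → A
  ≤2⇒no-three {X = X} ≤2 {u} {v} {w} u∈ v∈ w∈ u≢v u≢w v≢w = contradiction
    (ℕ.≤-trans (ℕ.≤-trans (ℕ.m≤m+n 3 _) (length+∣∖∣≤ X {u ∷ v ∷ w ∷ []} ((u≢v ∷ u≢w ∷ []) ∷ (v≢w ∷ []) ∷ [] ∷ [])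
      λ { (here refl) → u∈ ; (there (here refl)) → v∈ ; (there (there (here refl))) → w∈ })) ≤2)
    (λ { (s≤s (s≤s ())) })

  module LowerCore {m} (e : TCMfun m) (tcm : IsTCM e) where

    -- On a triple meeting both parts, 0,0,1 is permitted when its last row is in `V₂` and 1,1,0
    -- when it is in `V₁`; inside a part the choice is recursive. A small set has no triple of
    -- distinct rows, so `true` is arbitrary there. Nothing depends on a skeleton, so one function
    -- serves all of them.
    sep : ∀ {V} → Rec2 e V → Fin m → Fin m → Fin m → Bool
    sep (small _) _ _ _ = true
    sep (split V₁ V₂ _ _ _ _ _ r₁ r₂ _ _) u v w
      with (u ∈? V₁) ×-dec (v ∈? V₁) ×-dec (w ∈? V₁) | (u ∈? V₂) ×-dec (v ∈? V₂) ×-dec (w ∈? V₂)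
    ... | yes _ | _     = sep r₁ u v w
    ... | no _  | yes _ = sep r₂ u v w
    ... | no _  | no _  = does (w ∈? V₂)

    Many : (Fin m → Fin m → Fin m → Bool) → Subset m → List (Fin m × Fin m) → Set
    Many h X Q = ∃ λ L → Unique L × (∀ {O} → O L.∈ L → Allowed h X O) × 1 + ∣ X ∣ + length Q ≤ length L

    -- The conditions `lo` and `hi` need three distinct rows, so every subset is allowed. If `Q`
    -- contains a pair, all four subsets are taken; otherwise a chain from `⊥` to `X` is long
    -- enough.
    small-many : ∀ h X → ∣ X ∣ ≤ 2 → ∀ Q → Unique Q → All (FullPair e X X) Q → Many h X Q
    small-many h X ≤2 Q uQ fQ = go Q uQ fQ
      where
      any-allowed : ∀ {O} → O ⊆ X → Allowed h X O
      any-allowed O⊆X = record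
        { sub = O⊆X
        ; lo = λ u∈ v∈ w∈ u≢v u∉ v∉ w∈O → ≤2⇒no-three ≤2 u∈ v∈ w∈ u≢v (λ { refl → u∉ w∈O }) (λ { refl → v∉ w∈O })
        ; hi = λ u∈ v∈ w∈ u≢v u∈O v∈O w∉ → ≤2⇒no-three ≤2 u∈ v∈ w∈ u≢v (λ { refl → w∉ u∈O }) (λ { refl → w∉ v∈O }) }

      ≢-by : ∀ {O O′ : Subset m} x → x ∉ O → x ∈ O′ → O ≢ O′
      ≢-by x x∉ x∈ refl = x∉ x∈

      ⁅⁆⊆ : ∀ {x} → x ∈ X → ⁅ x ⁆ ⊆ X
      ⁅⁆⊆ {x} x∈ z∈ = subst (_∈ X) (sym (x∈⁅y⁆⇒x≡y x z∈)) x∈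

      go : ∀ Q → Unique Q → All (FullPair e X X) Q → Many h X Q
      go ((x , y) ∷ Q) uQ fQ@((x<y , x∈ , y∈ , _) ∷ _) = ⊥ ∷ ⁅ x ⁆ ∷ ⁅ y ⁆ ∷ X ∷ [] ,
        (≢-by x ∉⊥ (x∈⁅x⁆ x) ∷ ≢-by y ∉⊥ (x∈⁅x⁆ y) ∷ ≢-by x ∉⊥ x∈ ∷ []) ∷
        (≢-by y (x≢y⇒x∉⁅y⁆ (x≢y ∘ sym)) (x∈⁅x⁆ y) ∷ ≢-by y (x≢y⇒x∉⁅y⁆ (x≢y ∘ sym)) y∈ ∷ []) ∷
        (≢-by x (x≢y⇒x∉⁅y⁆ x≢y) x∈ ∷ []) ∷ [] ∷ [] ,
        (λ { (here refl) → any-allowed ⊥⊆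
           ; (there (here refl)) → any-allowed (⁅⁆⊆ x∈)
           ; (there (there (here refl))) → any-allowed (⁅⁆⊆ y∈)
           ; (there (there (there (here refl)))) → any-allowed (λ z → z) }) ,
        s≤s (ℕ.+-mono-≤ ≤2 (unique-⊆⇒length≤ {ys = (x , y) ∷ []} uQ λ q∈ → here (only (All.lookup fQ q∈))))
        where
        x≢y : x ≢ y
        x≢y = F.<⇒≢ x<y
        x-or-y : ∀ z → z ∈ X → (z ≡ x) ⊎ (z ≡ y)
        x-or-y z z∈ with z F.≟ x | z F.≟ y
        ... | yes p | _ = inj₁ p
        ... | no _ | yes p = inj₂ p
        ... | no z≢x | no z≢y = ≤2⇒no-three ≤2 z∈ x∈ y∈ z≢x z≢y x≢y
        only : ∀ {q} → FullPair e X X q → q ≡ (x , y)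
        only {x′ , y′} (lt , x′∈ , y′∈ , _) with x-or-y x′ x′∈ | x-or-y y′ y′∈
        ... | inj₁ refl | inj₂ refl = refl
        ... | inj₁ refl | inj₁ refl = contradiction lt (F.<-irrefl refl)
        ... | inj₂ refl | inj₂ refl = contradiction lt (F.<-irrefl refl)
        ... | inj₂ refl | inj₁ refl = contradiction lt (F.<-asym x<y)
      go [] _ _ with nonempty? X
      ... | no empty = ⊥ ∷ [] , [] ∷ [] , (λ { (here refl) → any-allowed ⊥⊆ }) ,
        s≤s (ℕ.≤-reflexive (trans (ℕ.+-identityʳ _) (trans (cong ∣_∣ (Empty-unique empty)) (∣⊥∣≡0 m))))
      ... | yes (x , x∈) with any? (λ y → (y ∈? X) ×-dec ¬? (y F.≟ x))
      ...   | yes (y , y∈ , y≢x) = ⊥ ∷ ⁅ x ⁆ ∷ X ∷ [] ,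
        (≢-by x ∉⊥ (x∈⁅x⁆ x) ∷ ≢-by x ∉⊥ x∈ ∷ []) ∷ (≢-by y (x≢y⇒x∉⁅y⁆ y≢x) y∈ ∷ []) ∷ [] ∷ [] ,
        (λ { (here refl) → any-allowed ⊥⊆
           ; (there (here refl)) → any-allowed (⁅⁆⊆ x∈)
           ; (there (there (here refl))) → any-allowed (λ z → z) }) ,
        s≤s (ℕ.≤-trans (ℕ.≤-reflexive (ℕ.+-identityʳ _)) ≤2)
      ...   | no none = ⊥ ∷ X ∷ [] , (≢-by x ∉⊥ x∈ ∷ []) ∷ [] ∷ [] ,
        (λ { (here refl) → any-allowed ⊥⊆ ; (there (here refl)) → any-allowed (λ z → z) }) ,
        s≤s (ℕ.≤-trans (ℕ.≤-reflexive (ℕ.+-identityʳ _)) (ℕ.≤-trans (p⊆q⇒∣p∣≤∣q∣ X⊆⁅x⁆) (ℕ.≤-reflexive (∣⁅x⁆∣≡1 x))))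
        where
        X⊆⁅x⁆ : X ⊆ ⁅ x ⁆
        X⊆⁅x⁆ {z} z∈ = subst (_∈ ⁅ x ⁆) (sym (decidable-stable (z F.≟ x) λ z≢x → none (z , z∈ , z≢x))) (x∈⁅x⁆ x)

    -- A triple meeting both parts never chooses a pair that crosses them. So a full pair across the
    -- parts leaves no third vertex in `X`, which is the case of `small-many`. Otherwise `Q` splits
    -- between the parts, and the two families are joined.
    many : ∀ {V} (r : Rec2 e V) X → X ⊆ V → ∀ Q → Unique Q → All (FullPair e X X) Q → Many (sep r) X Q
    many r@(small ≤2) X X⊆V Q uQ fQ = small-many (sep r) X (ℕ.≤-trans (p⊆q⇒∣p∣≤∣q∣ X⊆V) ≤2) Q uQ fQ
    many r@(split V₁ V₂ _ cover disjoint _ _ r₁ r₂ side₁ side₂) X X⊆V Q uQ fQ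
      with Any.any? (λ (x , y) → ¬? ((x ∈? V₁) ×-dec (y ∈? V₁)) ×-dec ¬? ((x ∈? V₂) ×-dec (y ∈? V₂))) Q
    ... | yes mixed with L.find mixed
    ...   | (x , y) , q∈ , ¬₁ , ¬₂ = small-many (sep r) X
        (ℕ.≤-trans (p⊆q⇒∣p∣≤∣q∣ X⊆xy) (ℕ.≤-trans (∣p∪q∣≤∣p∣+∣q∣ ⁅ x ⁆ ⁅ y ⁆)
          (ℕ.≤-reflexive (cong₂ _+_ (∣⁅x⁆∣≡1 x) (∣⁅x⁆∣≡1 y))))) Q uQ fQ
      where
      side : ∀ {z} → z ∈ X → (z ∈ V₁) ⊎ (z ∈ V₂)
      side z∈ = Equivalence.to (cover _) (X⊆V z∈)

      x<y = proj₁ (All.lookup fQ q∈)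
      x∈ = proj₁ (proj₂ (All.lookup fQ q∈))
      y∈ = proj₁ (proj₂ (proj₂ (All.lookup fQ q∈)))
      full = proj₂ (proj₂ (proj₂ (All.lookup fQ q∈)))
      x≢y : x ≢ y
      x≢y = F.<⇒≢ x<y

      -- The vertex `z` shares its part with `a` or `b`; the triple chooses that pair and omits the
      -- remaining end, not `z`.
      no-third : ∀ {a b z} → a ∈ V₁ → b ∈ V₂ → z ∈ X → a ≢ b → a ≢ z → b ≢ z → e a b z ≢ z
      no-third {a} {b} {z} a∈ b∈ z∈ a≢b a≢z b≢z eq with side z∈
      ... | inj₁ z∈₁ = b≢z (trans (sym (side₁ a z b a∈ z∈₁ b∈ a≢z))
                             (trans (sym (proj₂ (proj₂ (tcm a b z a≢b a≢z b≢z)))) eq))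
      ... | inj₂ z∈₂ = a≢z (trans (sym (side₂ a b z a∈ b∈ z∈₂ b≢z)) eq)

      third : ∀ {z} → z ∈ X → z ≢ x → z ≢ y → z ∈ ⁅ x ⁆ ∪ ⁅ y ⁆
      third {z} z∈ z≢x z≢y with side x∈ | side y∈
      ... | inj₁ p | inj₁ q = contradiction (p , q) ¬₁
      ... | inj₂ p | inj₂ q = contradiction (p , q) ¬₂
      ... | inj₁ p | inj₂ q = contradiction (full z z∈ z≢x z≢y)
              (no-third p q z∈ x≢y (z≢x ∘ sym) (z≢y ∘ sym))
      ... | inj₂ p | inj₁ q = contradiction
              (trans (sym (proj₁ (proj₂ (tcm x y z x≢y (z≢x ∘ sym) (z≢y ∘ sym))))) (full z z∈ z≢x z≢y))
              (no-third q p z∈ (x≢y ∘ sym) (z≢y ∘ sym) (z≢x ∘ sym))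

      X⊆xy : X ⊆ ⁅ x ⁆ ∪ ⁅ y ⁆
      X⊆xy {z} z∈ with z F.≟ x | z F.≟ y
      ... | yes refl | _ = x∈p∪q⁺ (inj₁ (x∈⁅x⁆ x))
      ... | no _ | yes refl = x∈p∪q⁺ (inj₂ (x∈⁅x⁆ y))
      ... | no z≢x | no z≢y = third z∈ z≢x z≢y
    many r@(split V₁ V₂ _ cover disjoint _ _ r₁ r₂ side₁ side₂) X X⊆V Q uQ fQ | no none
      with many r₁ X₁ (p∩q⊆q X V₁) (filter in₁? Q) (Unique.filter⁺ in₁? uQ) (All.tabulate full₁)
         | many r₂ X₂ (p∩q⊆q X V₂) (filter (¬? ∘ in₁?) Q) (Unique.filter⁺ _ uQ) (All.tabulate full₂)
      where
      X₁ = X ∩ V₁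
      X₂ = X ∩ V₂
      in₁? : Decidable (λ (q : Fin m × Fin m) → proj₁ q ∈ V₁ × proj₂ q ∈ V₁)
      in₁? (x , y) = (x ∈? V₁) ×-dec (y ∈? V₁)
      -- Fullness survives the restriction to a part, since fewer `w` are tested.
      full₁ : ∀ {q} → q L.∈ filter in₁? Q → FullPair e X₁ X₁ q
      full₁ q∈ = let q∈Q , x∈₁ , y∈₁ = L.∈-filter⁻ in₁? {xs = Q} q∈
                     x<y , x∈ , y∈ , full = All.lookup fQ q∈Q in
        x<y , x∈p∩q⁺ (x∈ , x∈₁) , x∈p∩q⁺ (y∈ , y∈₁) , λ w w∈ → full w (p∩q⊆p X V₁ w∈)
      full₂ : ∀ {q} → q L.∈ filter (¬? ∘ in₁?) Q → FullPair e X₂ X₂ q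
      full₂ {x , y} q∈ = let q∈Q , ¬in₁ = L.∈-filter⁻ (¬? ∘ in₁?) {xs = Q} q∈
                             x<y , x∈ , y∈ , full = All.lookup fQ q∈Q
                             x∈₂ , y∈₂ = decidable-stable ((x ∈? V₂) ×-dec (y ∈? V₂)) λ ¬in₂ → none (L.lose q∈Q (¬in₁ , ¬in₂)) in
        x<y , x∈p∩q⁺ (x∈ , x∈₂) , x∈p∩q⁺ (y∈ , y∈₂) , λ w w∈ → full w (p∩q⊆p X V₂ w∈)
    ... | L₁ , u₁ , ok₁ , le₁ | L₂ , u₂ , ok₂ , le₂ = map (_∪ X₂) L₁ ++ L₂′ , uniq , ok , count
      where
      X₁ = X ∩ V₁
      X₂ = X ∩ V₂
      in₁? : Decidable (λ (q : Fin m × Fin m) → proj₁ q ∈ V₁ × proj₂ q ∈ V₁)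
      in₁? (x , y) = (x ∈? V₁) ×-dec (y ∈? V₁)
      top? : Decidable (_≡ X₂)
      top? O = O ≟ₛ X₂
      -- `X₂` may also arise as `⊥ ∪ X₂` from the first family, so it is dropped from the second.
      L₂′ = filter (¬? ∘ top?) L₂

      side : ∀ {z} → z ∈ X → (z ∈ V₁) ⊎ (z ∈ V₂)
      side z∈ = Equivalence.to (cover _) (X⊆V z∈)

      V₁∩X₂ : ∀ {z} → z ∈ V₁ → z ∉ X₂
      V₁∩X₂ z∈ q = disjoint _ z∈ (p∩q⊆q X V₂ q)

      sub₁ : ∀ {O z} → O L.∈ L₁ → z ∈ O → z ∈ V₁
      sub₁ O∈ z∈ = p∩q⊆q X V₁ (sub (ok₁ O∈) z∈)

      sub₂ : ∀ {O z} → O L.∈ L₂ → z ∈ O → z ∈ V₂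
      sub₂ O∈ z∈ = p∩q⊆q X V₂ (sub (ok₂ O∈) z∈)

      ∪-cancel : ∀ {O O′} → O L.∈ L₁ → O ∪ X₂ ≡ O′ ∪ X₂ → O ⊆ O′
      ∪-cancel {O} {O′} O∈ eq z∈ with x∈p∪q⁻ O′ X₂ (subst (_ ∈_) eq (x∈p∪q⁺ (inj₁ z∈)))
      ... | inj₁ z∈′ = z∈′
      ... | inj₂ z∈₂ = contradiction z∈₂ (V₁∩X₂ (sub₁ O∈ z∈))

      uniq : Unique (map (_∪ X₂) L₁ ++ L₂′)
      uniq = Unique.++⁺
        (unique-map⁺ (_∪ X₂) (λ O∈ O′∈ eq → ⊆-antisym (∪-cancel O∈ eq) (∪-cancel O′∈ (sym eq))) u₁)
        (Unique.filter⁺ _ u₂)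
        λ {O} (O∈₁ , O∈₂′) → let O₁ , O₁∈ , eq = L.∈-map⁻ (_∪ X₂) O∈₁
                                 O∈₂ , O≢ = L.∈-filter⁻ (¬? ∘ top?) {xs = L₂} O∈₂′ in
          O≢ (⊆-antisym (sub (ok₂ O∈₂)) λ z∈ → subst (_ ∈_) (sym eq) (x∈p∪q⁺ (inj₂ z∈)))

      -- All zeros of `O ∪ X₂` lie in `V₁`. So a mixed 0,0,1 ends in `V₂` and a mixed 1,1,0 ends in
      -- `V₁`, as `sep` permits.
      ok-left : ∀ {O} → O L.∈ L₁ → Allowed (sep r) X (O ∪ X₂)
      ok-left {O} O∈ = record { sub = sub′ ; lo = lo′ ; hi = hi′ }
        where
        sub′ : O ∪ X₂ ⊆ X
        sub′ z∈ with x∈p∪q⁻ O X₂ z∈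
        ... | inj₁ z∈O = p∩q⊆p X V₁ (sub (ok₁ O∈) z∈O)
        ... | inj₂ z∈₂ = p∩q⊆p X V₂ z∈₂
        from : ∀ {z} → z ∈ V₁ → z ∈ O ∪ X₂ → z ∈ O
        from z∈₁ z∈ with x∈p∪q⁻ O X₂ z∈
        ... | inj₁ z∈O = z∈O
        ... | inj₂ z∈₂ = contradiction z∈₂ (V₁∩X₂ z∈₁)
        out : ∀ {z} → z ∈ X → z ∉ O ∪ X₂ → z ∈ V₁
        out z∈ z∉ with side z∈
        ... | inj₁ z∈₁ = z∈₁
        ... | inj₂ z∈₂ = contradiction (x∈p∪q⁺ (inj₂ (x∈p∩q⁺ (z∈ , z∈₂)))) z∉
        lo′ : ∀ {u v w} → u ∈ X → v ∈ X → w ∈ X → u ≢ v → u ∉ O ∪ X₂ → v ∉ O ∪ X₂ → w ∈ O ∪ X₂ → sep r u v w ≡ true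
        lo′ {u} {v} {w} u∈ v∈ w∈ u≢v u∉ v∉ w∈O
          with (u ∈? V₁) ×-dec (v ∈? V₁) ×-dec (w ∈? V₁) | (u ∈? V₂) ×-dec (v ∈? V₂) ×-dec (w ∈? V₂)
        ... | yes (a , b , c) | _ = lo (ok₁ O∈) (x∈p∩q⁺ (u∈ , a)) (x∈p∩q⁺ (v∈ , b)) (x∈p∩q⁺ (w∈ , c)) u≢v
                (u∉ ∘ x∈p∪q⁺ ∘ inj₁) (v∉ ∘ x∈p∪q⁺ ∘ inj₁) (from c w∈O)
        ... | no _ | yes (a , _) = contradiction (out u∈ u∉) (λ p → disjoint _ p a)
        ... | no ¬₁ | no _ with side w∈
        ...   | inj₁ c = contradiction (out u∈ u∉ , out v∈ v∉ , c) ¬₁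
        ...   | inj₂ c = dec-true (w ∈? V₂) c
        hi′ : ∀ {u v w} → u ∈ X → v ∈ X → w ∈ X → u ≢ v → u ∈ O ∪ X₂ → v ∈ O ∪ X₂ → w ∉ O ∪ X₂ → sep r u v w ≡ false
        hi′ {u} {v} {w} u∈ v∈ w∈ u≢v u∈O v∈O w∉
          with (u ∈? V₁) ×-dec (v ∈? V₁) ×-dec (w ∈? V₁) | (u ∈? V₂) ×-dec (v ∈? V₂) ×-dec (w ∈? V₂)
        ... | yes (a , b , c) | _ = hi (ok₁ O∈) (x∈p∩q⁺ (u∈ , a)) (x∈p∩q⁺ (v∈ , b)) (x∈p∩q⁺ (w∈ , c)) u≢v
                (from a u∈O) (from b v∈O) (w∉ ∘ x∈p∪q⁺ ∘ inj₁)
        ... | no _ | yes (_ , _ , c) = contradiction (out w∈ w∉) (λ p → disjoint _ p c)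
        ... | no _ | no _ = dec-false (w ∈? V₂) (disjoint w (out w∈ w∉))

      -- Dually, all ones of `O` lie in `V₂`: a mixed 0,0,1 ends in `V₂`, and a mixed 1,1,0 has its
      -- ones in `V₂`, so it ends in `V₁`.
      ok-right : ∀ {O} → O L.∈ L₂ → Allowed (sep r) X O
      ok-right {O} O∈ = record { sub = p∩q⊆p X V₂ ∘ sub (ok₂ O∈) ; lo = lo′ ; hi = hi′ }
        where
        lo′ : ∀ {u v w} → u ∈ X → v ∈ X → w ∈ X → u ≢ v → u ∉ O → v ∉ O → w ∈ O → sep r u v w ≡ true
        lo′ {u} {v} {w} u∈ v∈ w∈ u≢v u∉ v∉ w∈O
          with (u ∈? V₁) ×-dec (v ∈? V₁) ×-dec (w ∈? V₁) | (u ∈? V₂) ×-dec (v ∈? V₂) ×-dec (w ∈? V₂)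
        ... | yes (_ , _ , c) | _ = contradiction (sub₂ O∈ w∈O) (disjoint _ c)
        ... | no _ | yes (a , b , c) = lo (ok₂ O∈) (x∈p∩q⁺ (u∈ , a)) (x∈p∩q⁺ (v∈ , b)) (x∈p∩q⁺ (w∈ , c)) u≢v u∉ v∉ w∈O
        ... | no _ | no _ = dec-true (w ∈? V₂) (sub₂ O∈ w∈O)
        hi′ : ∀ {u v w} → u ∈ X → v ∈ X → w ∈ X → u ≢ v → u ∈ O → v ∈ O → w ∉ O → sep r u v w ≡ false
        hi′ {u} {v} {w} u∈ v∈ w∈ u≢v u∈O v∈O w∉
          with (u ∈? V₁) ×-dec (v ∈? V₁) ×-dec (w ∈? V₁) | (u ∈? V₂) ×-dec (v ∈? V₂) ×-dec (w ∈? V₂)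
        ... | yes (a , _) | _ = contradiction (sub₂ O∈ u∈O) (disjoint _ a)
        ... | no _ | yes (a , b , c) = hi (ok₂ O∈) (x∈p∩q⁺ (u∈ , a)) (x∈p∩q⁺ (v∈ , b)) (x∈p∩q⁺ (w∈ , c)) u≢v u∈O v∈O w∉
        ... | no _ | no ¬₂ = dec-false (w ∈? V₂) λ c → ¬₂ (sub₂ O∈ u∈O , sub₂ O∈ v∈O , c)

      ok : ∀ {O} → O L.∈ map (_∪ X₂) L₁ ++ L₂′ → Allowed (sep r) X O
      ok O∈ with L.∈-++⁻ (map (_∪ X₂) L₁) O∈
      ... | inj₁ O∈₁ = let O₁ , O₁∈ , eq = L.∈-map⁻ (_∪ X₂) O∈₁ in subst (Allowed (sep r) X) (sym eq) (ok-left O₁∈)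
      ... | inj₂ O∈₂ = ok-right (proj₁ (L.∈-filter⁻ (¬? ∘ top?) {xs = L₂} O∈₂))

      L₂-split : length L₂ ≤ 1 + length L₂′
      L₂-split = ℕ.≤-trans (ℕ.≤-reflexive (length-filter-split top? L₂))
        (ℕ.+-monoˡ-≤ (length L₂′) (unique-⊆⇒length≤ {ys = X₂ ∷ []} (Unique.filter⁺ top? u₂)
          λ O∈ → here (proj₂ (L.∈-filter⁻ top? {xs = L₂} O∈))))

      X⊆X₁∪X₂ : X ⊆ X₁ ∪ X₂
      X⊆X₁∪X₂ z∈ with side z∈
      ... | inj₁ z∈₁ = x∈p∪q⁺ (inj₁ (x∈p∩q⁺ (z∈ , z∈₁)))
      ... | inj₂ z∈₂ = x∈p∪q⁺ (inj₂ (x∈p∩q⁺ (z∈ , z∈₂)))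

      q₁ = length (filter in₁? Q)
      q₂ = length (filter (¬? ∘ in₁?) Q)

      rearrange : ∀ a b c d → 1 + (1 + (a + b) + (c + d)) ≡ (1 + a + c) + (1 + b + d)
      rearrange = solve-∀

      count : 1 + ∣ X ∣ + length Q ≤ length (map (_∪ X₂) L₁ ++ L₂′)
      -- The bounds for the two parts contribute a summand 1 each where the target has only one. The
      -- surplus pays for the set dropped in `L₂′`.
      count = ℕ.≤-pred (begin
        1 + (1 + ∣ X ∣ + length Q)                   ≤⟨ s≤s (s≤s (ℕ.+-monoˡ-≤ (length Q)
                                                         (ℕ.≤-trans (p⊆q⇒∣p∣≤∣q∣ X⊆X₁∪X₂) (∣p∪q∣≤∣p∣+∣q∣ X₁ X₂)))) ⟩
        1 + (1 + (∣ X₁ ∣ + ∣ X₂ ∣) + length Q)      ≡⟨ cong (λ q → 1 + (1 + (∣ X₁ ∣ + ∣ X₂ ∣) + q)) (length-filter-split in₁? Q) ⟩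
        1 + (1 + (∣ X₁ ∣ + ∣ X₂ ∣) + (q₁ + q₂))     ≡⟨ rearrange (∣ X₁ ∣) (∣ X₂ ∣) q₁ q₂ ⟩
        (1 + ∣ X₁ ∣ + q₁) + (1 + ∣ X₂ ∣ + q₂)       ≤⟨ ℕ.+-mono-≤ le₁ le₂ ⟩
        length L₁ + length L₂                        ≤⟨ ℕ.+-monoʳ-≤ (length L₁) L₂-split ⟩
        length L₁ + (1 + length L₂′)                 ≡⟨ ℕ.+-suc (length L₁) _ ⟩
        1 + (length L₁ + length L₂′)                 ≡⟨ cong (λ k → 1 + (k + length L₂′)) (length-map (_∪ X₂) L₁) ⟨
        1 + (length (map (_∪ X₂) L₁) + length L₂′)   ≡⟨ cong ℕ.suc (length-++ (map (_∪ X₂) L₁)) ⟨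
        1 + length (map (_∪ X₂) L₁ ++ L₂′) ∎)
        where open ℕ.≤-Reasoning

  -- Sums over lists

  sumL : (A → ℕ) → List A → ℕ
  sumL f [] = 0
  sumL f (x ∷ xs) = f x + sumL f xs

  sumL-cong : {f g : A → ℕ} → (∀ x → f x ≡ g x) → ∀ xs → sumL f xs ≡ sumL g xs
  sumL-cong f≗g [] = refl
  sumL-cong f≗g (x ∷ xs) = cong₂ _+_ (f≗g x) (sumL-cong f≗g xs)

  sumL-mono : {f g : A → ℕ} → (∀ x → f x ≤ g x) → ∀ xs → sumL f xs ≤ sumL g xs
  sumL-mono f≤g [] = z≤n
  sumL-mono f≤g (x ∷ xs) = ℕ.+-mono-≤ (f≤g x) (sumL-mono f≤g xs)

  sumL-+ : (f g : A → ℕ) → ∀ xs → sumL (λ x → f x + g x) xs ≡ sumL f xs + sumL g xs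
  sumL-+ f g [] = refl
  sumL-+ f g (x ∷ xs) = trans (cong (f x + g x +_) (sumL-+ f g xs)) (interchange (f x) (g x) _ _)

  sumL-0 : (xs : List A) → sumL (λ _ → 0) xs ≡ 0
  sumL-0 [] = refl
  sumL-0 (x ∷ xs) = sumL-0 xs

  sumL-*ˡ : (c : ℕ) (f : A → ℕ) → ∀ xs → sumL (λ x → c * f x) xs ≡ c * sumL f xs
  sumL-*ˡ c f [] = sym (ℕ.*-zeroʳ c)
  sumL-*ˡ c f (x ∷ xs) = trans (cong (c * f x +_) (sumL-*ˡ c f xs)) (sym (ℕ.*-distribˡ-+ c (f x) _))

  sumL-swap : (f : A → B → ℕ) → ∀ xs ys → sumL (λ x → sumL (f x) ys) xs ≡ sumL (λ y → sumL (λ x → f x y) xs) ys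
  sumL-swap f [] ys = sym (sumL-0 ys)
  sumL-swap f (x ∷ xs) ys = trans (cong (sumL (f x) ys +_) (sumL-swap f xs ys)) (sym (sumL-+ (f x) _ ys))

  sumL-++ : (f : A → ℕ) → ∀ xs ys → sumL f (xs ++ ys) ≡ sumL f xs + sumL f ys
  sumL-++ f [] ys = refl
  sumL-++ f (x ∷ xs) ys = trans (cong (f x +_) (sumL-++ f xs ys)) (sym (ℕ.+-assoc (f x) _ _))

  sumL-map : (f : B → ℕ) (g : A → B) → ∀ xs → sumL f (map g xs) ≡ sumL (f ∘ g) xs
  sumL-map f g [] = refl
  sumL-map f g (x ∷ xs) = cong (f (g x) +_) (sumL-map f g xs)

  sumL-cartesianProductWith : {C : Set} (f : C → ℕ) (g : A → B → C) → ∀ xs ys →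
    sumL f (cartesianProductWith g xs ys) ≡ sumL (λ x → sumL (λ y → f (g x y)) ys) xs
  sumL-cartesianProductWith f g [] ys = refl
  sumL-cartesianProductWith f g (x ∷ xs) ys = trans (sumL-++ f (map (g x) ys) _)
    (cong₂ _+_ (sumL-map f (g x) ys) (sumL-cartesianProductWith f g xs ys))

  length-concatMap : (f : A → List B) → ∀ xs → length (concatMap f xs) ≡ sumL (length ∘ f) xs
  length-concatMap f [] = refl
  length-concatMap f (x ∷ xs) = trans (length-++ (f x)) (cong (length (f x) +_) (length-concatMap f xs))

  unique-concatMap⁺ : (f : A → List B) → (∀ x → Unique (f x)) →
    (∀ {x y z} → z L.∈ f x → z L.∈ f y → x ≡ y) → ∀ {xs} → Unique xs → Unique (concatMap f xs)
  unique-concatMap⁺ f uf dis [] = []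
  unique-concatMap⁺ f uf dis {x ∷ xs} (x∉ ∷ u) = Unique.++⁺ (uf x) (unique-concatMap⁺ f uf dis u)
    λ (p , q) → let y , y∈ , z∈ = L.find (L.∈-concatMap⁻ f {xs = xs} q) in All.lookup x∉ y∈ (dis p z∈)

  ∈⇒≤sumL : (f : A → ℕ) → ∀ {x xs} → x L.∈ xs → f x ≤ sumL f xs
  ∈⇒≤sumL f (here refl) = ℕ.m≤m+n _ _
  ∈⇒≤sumL f {xs = y ∷ _} (there x∈) = ℕ.≤-trans (∈⇒≤sumL f x∈) (ℕ.m≤n+m _ (f y))

  bit : Bool → ℕ
  bit p = if p then 1 else 0

  length≤∑fibres : (_≈?_ : DecidableEquality B) (f : A → B) → ∀ xs ys → (∀ x → f x L.∈ ys) →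
    length xs ≤ sumL (λ y → length (filter (λ x → f x ≈? y) xs)) ys
  length≤∑fibres _≈?_ f [] ys _ = z≤n
  length≤∑fibres _≈?_ f (x ∷ xs) ys all = begin
    1 + length xs
      ≤⟨ ℕ.+-mono-≤ (ℕ.≤-trans (ℕ.≤-reflexive (sym (cong bit (dec-true (f x ≈? f x) refl))))
           (∈⇒≤sumL (λ y → bit (does (f x ≈? y))) (all x))) (length≤∑fibres _≈?_ f xs ys all) ⟩
    sumL (λ y → bit (does (f x ≈? y))) ys + sumL (λ y → length (filter (λ x → f x ≈? y) xs)) ys
      ≡⟨ sumL-+ _ _ ys ⟨
    sumL (λ y → bit (does (f x ≈? y)) + length (filter (λ x → f x ≈? y) xs)) ys
      ≡⟨ sumL-cong (λ y → head y) ys ⟩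
    sumL (λ y → length (filter (λ x → f x ≈? y) (x ∷ xs))) ys ∎
    where
    open ℕ.≤-Reasoning
    head : ∀ y → bit (does (f x ≈? y)) + length (filter (λ x → f x ≈? y) xs) ≡ length (filter (λ x → f x ≈? y) (x ∷ xs))
    head y with does (f x ≈? y)
    ... | true = refl
    ... | false = refl

  length-filter-≟1 : (f : A → ℕ) → (∀ x → f x ≤ 1) → ∀ xs → length (filter (λ x → f x ℕ.≟ 1) xs) ≡ sumL f xs
  length-filter-≟1 f f≤1 [] = refl
  length-filter-≟1 f f≤1 (x ∷ xs) with f x | f≤1 x
  ... | 0 | _ = length-filter-≟1 f f≤1 xs
  ... | 1 | _ = cong ℕ.suc (length-filter-≟1 f f≤1 xs)
  ... | ℕ.suc (ℕ.suc _) | s≤s ()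

  -- Sums and products over rows and over words

  sumF : (n : ℕ) → (Fin n → ℕ) → ℕ
  sumF 0 f = 0
  sumF (ℕ.suc n) f = f zero + sumF n (f ∘ suc)

  prodF : (n : ℕ) → (Fin n → ℕ) → ℕ
  prodF 0 f = 1
  prodF (ℕ.suc n) f = f zero * prodF n (f ∘ suc)

  sumF-const : ∀ n c → sumF n (λ _ → c) ≡ n * c
  sumF-const 0 c = refl
  sumF-const (ℕ.suc n) c = cong (c +_) (sumF-const n c)

  prodF-cong : ∀ n {f g : Fin n → ℕ} → (∀ i → f i ≡ g i) → prodF n f ≡ prodF n g
  prodF-cong 0 _ = refl
  prodF-cong (ℕ.suc n) eq = cong₂ _*_ (eq zero) (prodF-cong n (eq ∘ suc))

  sumL-tabulate : ∀ n (f : A → ℕ) (g : Fin n → A) → sumL f (tabulate g) ≡ sumF n (f ∘ g)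
  sumL-tabulate 0 f g = refl
  sumL-tabulate (ℕ.suc n) f g = cong (f (g zero) +_) (sumL-tabulate n f (g ∘ suc))

  sumL-allFin : ∀ n (f : Fin n → ℕ) → sumL f (allFin n) ≡ sumF n f
  sumL-allFin n f = sumL-tabulate n f (λ i → i)

  bit≤1 : ∀ p → bit p ≤ 1
  bit≤1 true = s≤s z≤n
  bit≤1 false = z≤n

  prodF-bit≤1 : ∀ n (p : Fin n → Bool) → prodF n (bit ∘ p) ≤ 1
  prodF-bit≤1 0 p = s≤s z≤n
  prodF-bit≤1 (ℕ.suc n) p = ℕ.*-mono-≤ (bit≤1 (p zero)) (prodF-bit≤1 n (p ∘ suc))

  prodF-bit⁺ : ∀ n (p : Fin n → Bool) → (∀ i → p i ≡ true) → prodF n (bit ∘ p) ≡ 1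
  prodF-bit⁺ 0 p all = refl
  prodF-bit⁺ (ℕ.suc n) p all rewrite all zero = trans (ℕ.+-identityʳ _) (prodF-bit⁺ n (p ∘ suc) (all ∘ suc))

  prodF-bit⁻ : ∀ n (p : Fin n → Bool) → prodF n (bit ∘ p) ≡ 1 → ∀ i → p i ≡ true
  prodF-bit⁻ (ℕ.suc n) p eq i with p zero in eq₀
  prodF-bit⁻ (ℕ.suc n) p eq zero | true = eq₀
  prodF-bit⁻ (ℕ.suc n) p eq (suc i) | true = prodF-bit⁻ n (p ∘ suc) (trans (sym (ℕ.+-identityʳ _)) eq) i

  allWords : ∀ q m → List (Vec (Fin q) m)
  allWords q 0 = [] ∷ []
  allWords q (ℕ.suc m) = cartesianProductWith _∷_ (allFin q) (allWords q m)

  ∈-allWords : ∀ {q m} (κ : Vec (Fin q) m) → κ L.∈ allWords q m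
  ∈-allWords [] = here refl
  ∈-allWords (v ∷ κ) = L.∈-cartesianProductWith⁺ _∷_ (L.∈-allFin v) (∈-allWords κ)

  allWords-unique : ∀ q m → Unique (allWords q m)
  allWords-unique q 0 = All.[] ∷ []
  allWords-unique q (ℕ.suc m) = Unique.cartesianProductWith⁺ _∷_ Vec.∷-injective (allFin⁺ q) (allWords-unique q m)

  sumL-allWords : ∀ q m (f : Vec (Fin q) (ℕ.suc m) → ℕ) →
    sumL f (allWords q (ℕ.suc m)) ≡ sumF q (λ v → sumL (λ κ → f (v ∷ κ)) (allWords q m))
  sumL-allWords q m f = trans (sumL-cartesianProductWith f _∷_ (allFin q) (allWords q m)) (sumL-allFin q _)

  sumF-cong : ∀ n {f g : Fin n → ℕ} → (∀ i → f i ≡ g i) → sumF n f ≡ sumF n g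
  sumF-cong 0 _ = refl
  sumF-cong (ℕ.suc n) eq = cong₂ _+_ (eq zero) (sumF-cong n (eq ∘ suc))

  sumF-*ʳ : ∀ n (f : Fin n → ℕ) c → sumF n (λ i → f i * c) ≡ sumF n f * c
  sumF-*ʳ 0 f c = refl
  sumF-*ʳ (ℕ.suc n) f c = trans (cong (f zero * c +_) (sumF-*ʳ n (f ∘ suc) c)) (sym (ℕ.*-distribʳ-+ c (f zero) _))

  -- Expanding the product of sums picks one symbol per row, independently, which is the choice of a
  -- word.
  sumL-prodF : ∀ q m (f : Fin m → Fin q → ℕ) →
    sumL (λ κ → prodF m (λ i → f i (lookup κ i))) (allWords q m) ≡ prodF m (λ i → sumF q (f i))
  sumL-prodF q 0 f = refl
  sumL-prodF q (ℕ.suc m) f = begin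
    sumL (λ κ → prodF (ℕ.suc m) (λ i → f i (lookup κ i))) (allWords q (ℕ.suc m))
      ≡⟨ sumL-allWords q m _ ⟩
    sumF q (λ v → sumL (λ κ → f zero v * prodF m (λ i → f (suc i) (lookup κ i))) (allWords q m))
      ≡⟨ sumF-cong q (λ v → trans (sumL-*ˡ (f zero v) _ (allWords q m)) (cong (f zero v *_) (sumL-prodF q m (f ∘ suc)))) ⟩
    sumF q (λ v → f zero v * prodF m (λ i → sumF q (f (suc i))))
      ≡⟨ sumF-*ʳ q (f zero) _ ⟩
    sumF q (f zero) * prodF m (λ i → sumF q (f (suc i))) ∎
    where open ≡-Reasoning

  sumL-1 : ∀ q m → sumL (λ _ → 1) (allWords q m) ≡ q ^ m
  sumL-1 q 0 = refl
  sumL-1 q (ℕ.suc m) = trans (sumL-allWords q m _)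
    (trans (sumF-const q _) (cong (q *_) (sumL-1 q m)))

  isZero : ∀ {n} → Fin (ℕ.suc n) → Bool
  isZero zero = true
  isZero (suc _) = false

  -- In a skeleton, `zero` is the symbol that merges the entries 0 and 1, so this is the set U of
  -- the overview.
  zeros : ∀ {b m} → Vec (Fin (ℕ.suc b)) m → Subset m
  zeros = Vec.map isZero

  ∈zeros⁺ : ∀ {b m} (κ : Vec (Fin (ℕ.suc b)) m) x → isZero (lookup κ x) ≡ true → x ∈ zeros κ
  ∈zeros⁺ κ x eq = Vec.lookup⇒[]= x _ (trans (Vec.lookup-map x isZero κ) eq)

  ∈zeros⁻ : ∀ {b m} (κ : Vec (Fin (ℕ.suc b)) m) x → x ∈ zeros κ → isZero (lookup κ x) ≡ true
  ∈zeros⁻ κ x x∈ = trans (sym (Vec.lookup-map x isZero κ)) (Vec.[]=⇒lookup x∈)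

  -- Double counting: one of `m` rows carries `zero` and the other rows are free. The induction
  -- separates the first letter `zero` from the `b` other letters.
  sumL-∣zeros∣ : ∀ b m → sumL (λ κ → ∣ zeros κ ∣) (allWords (ℕ.suc b) m) ≡ m * ℕ.suc b ^ (m ∸ 1)
  sumL-∣zeros∣ b 0 = refl
  sumL-∣zeros∣ b (ℕ.suc m) = begin
    sumL (λ κ → ∣ zeros κ ∣) (allWords a (ℕ.suc m))
      ≡⟨ sumL-allWords a m _ ⟩
    sumL (λ κ → 1 + ∣ zeros κ ∣) (allWords a m) + sumF b (λ _ → Z)
      ≡⟨ cong₂ _+_ (trans (sumL-+ (λ _ → 1) (λ κ → ∣ zeros κ ∣) (allWords a m)) (cong (_+ Z) (sumL-1 a m))) (sumF-const b Z) ⟩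
    a ^ m + Z + b * Z
      ≡⟨ ℕ.+-assoc (a ^ m) Z _ ⟩
    a ^ m + a * Z
      ≡⟨ cong (λ z → a ^ m + a * z) (sumL-∣zeros∣ b m) ⟩
    a ^ m + a * (m * a ^ (m ∸ 1))
      ≡⟨ cong (a ^ m +_) (shift m) ⟩
    a ^ m + m * a ^ m ∎
    where
    open ≡-Reasoning
    a = ℕ.suc b
    Z = sumL (λ κ → ∣ zeros κ ∣) (allWords a m)
    -- The exponent is truncated at `m = 0`, where the factor `m` makes both sides vanish.
    shift : ∀ m → a * (m * a ^ (m ∸ 1)) ≡ m * a ^ m
    shift 0 = ℕ.*-zeroʳ a
    shift (ℕ.suc m) = begin
      a * (ℕ.suc m * a ^ m)   ≡⟨ ℕ.*-assoc a (ℕ.suc m) _ ⟨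
      a * ℕ.suc m * a ^ m     ≡⟨ cong (_* a ^ m) (ℕ.*-comm a (ℕ.suc m)) ⟩
      ℕ.suc m * a * a ^ m     ≡⟨ ℕ.*-assoc (ℕ.suc m) a _ ⟩
      ℕ.suc m * (a * a ^ m) ∎

  countFin-cong : ∀ n {p q : Fin n → Bool} → (∀ i → p i ≡ q i) → countFin n p ≡ countFin n q
  countFin-cong 0 _ = refl
  countFin-cong (ℕ.suc n) eq = cong₂ _+_ (cong bit (eq zero)) (countFin-cong n (eq ∘ suc))

  countFin-false : ∀ n → countFin n (λ _ → false) ≡ 0
  countFin-false 0 = refl
  countFin-false (ℕ.suc n) = countFin-false n

  countFin-≟ : ∀ n (x : Fin n) → countFin n (λ w → does (w ≟ x)) ≡ 1
  countFin-≟ (ℕ.suc n) zero = cong ℕ.suc (countFin-false n)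
  countFin-≟ (ℕ.suc n) (suc x) = countFin-≟ n x

  countFin-∨ : ∀ n (p q : Fin n → Bool) → (∀ i → p i ∧ q i ≡ false) →
    countFin n (λ i → p i ∨ q i) ≡ countFin n p + countFin n q
  countFin-∨ 0 p q dis = refl
  countFin-∨ (ℕ.suc n) p q dis = trans
    (cong₂ _+_ (head (p zero) (q zero) (dis zero)) (countFin-∨ n (p ∘ suc) (q ∘ suc) (dis ∘ suc)))
    (interchange (bit (p zero)) (bit (q zero)) _ _)
    where
    head : ∀ p q → p ∧ q ≡ false → bit (p ∨ q) ≡ bit p + bit q
    head true false _ = refl
    head false q _ = refl

  countFin-partition : ∀ n (s c : Fin n → Bool) → countFin n s +
    (countFin n (λ i → not (s i) ∧ c i) + countFin n (λ i → not (s i) ∧ not (c i))) ≡ n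
  countFin-partition 0 s c = refl
  countFin-partition (ℕ.suc n) s c = trans
    (trans (cong (bit (s zero) + N₁ +_) (interchange (bit (not (s zero) ∧ c zero)) N₂ _ N₃))
      (interchange (bit (s zero)) N₁ _ (N₂ + N₃)))
    (cong₂ _+_ (head (s zero) (c zero)) (countFin-partition n (s ∘ suc) (c ∘ suc)))
    where
    N₁ = countFin n (s ∘ suc)
    N₂ = countFin n (λ i → not (s (suc i)) ∧ c (suc i))
    N₃ = countFin n (λ i → not (s (suc i)) ∧ not (c (suc i)))
    head : ∀ s c → bit s + (bit (not s ∧ c) + bit (not s ∧ not c)) ≡ 1
    head true c = refl
    head false true = refl
    head false false = refl

  prodF-if : ∀ n (s c : Fin n → Bool) a b → prodF n (λ i → if s i then 1 else (if c i then a else b)) ≡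
    a ^ countFin n (λ i → not (s i) ∧ c i) * b ^ countFin n (λ i → not (s i) ∧ not (c i))
  prodF-if 0 s c a b = refl
  prodF-if (ℕ.suc n) s c a b with s zero | c zero
  ... | true  | _ = trans (ℕ.+-identityʳ _) (prodF-if n (s ∘ suc) (c ∘ suc) a b)
  ... | false | true = trans (cong (a *_) (prodF-if n (s ∘ suc) (c ∘ suc) a b)) (sym (ℕ.*-assoc a _ _))
  ... | false | false = trans (cong (b *_) (prodF-if n (s ∘ suc) (c ∘ suc) a b)) (x∙yz≈y∙xz b (a ^ N c) (b ^ N (not ∘ c)))
    where
    N : (Fin (ℕ.suc n) → Bool) → ℕ
    N d = countFin n (λ i → not (s (suc i)) ∧ d (suc i))

  -- Counting the skeletons in which a pair is full

  module PairSums (b : ℕ) {m : ℕ} (e : TCMfun m) where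

    a : ℕ
    a = ℕ.suc b

    Word : Set
    Word = Vec (Fin a) m

    end : Fin m → Fin m → Fin m → Bool
    end x y w = does (w ≟ x) ∨ does (w ≟ y)

    chosen : Fin m → Fin m → Fin m → Bool
    chosen x y w = does (e x y w ≟ w)

    -- Fullness of a pair, row by row: an end must carry the merged symbol, a row whose triple
    -- chooses the pair is free, and any other row must avoid the merged symbol.
    fits : Bool → Bool → Fin a → Bool
    fits s c v = if s then isZero v else (c ∨ not (isZero v))

    -- The indicator is written as a product over the rows so that its sum over all words factors.
    fullBit : Word → Fin m → Fin m → ℕ
    fullBit κ x y = if does (x <? y) then prodF m (λ w → bit (fits (end x y w) (chosen x y w) (lookup κ w))) else 0

    fullBit≤1 : ∀ κ x y → fullBit κ x y ≤ 1
    fullBit≤1 κ x y with does (x <? y)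
    ... | true = prodF-bit≤1 m _
    ... | false = z≤n

    fullBit⁺ : ∀ κ x y → FullPair e (zeros κ) (zeros κ) (x , y) → fullBit κ x y ≡ 1
    fullBit⁺ κ x y (x<y , x∈ , y∈ , full) rewrite dec-true (x <? y) x<y = prodF-bit⁺ m _ all
      where
      all : ∀ w → fits (end x y w) (chosen x y w) (lookup κ w) ≡ true
      all w with w ≟ x | w ≟ y
      ... | yes refl | _ = ∈zeros⁻ κ w x∈
      ... | no _ | yes refl = ∈zeros⁻ κ w y∈
      ... | no w≢x | no w≢y with lookup κ w in eq
      ...   | suc _ with chosen x y w
      ...     | true = refl
      ...     | false = refl
      all w | no w≢x | no w≢y | zero
        rewrite dec-true (e x y w ≟ w) (full w (∈zeros⁺ κ w (cong isZero eq)) w≢x w≢y) = refl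

    fullBit⁻ : ∀ κ x y → fullBit κ x y ≡ 1 → FullPair e (zeros κ) (zeros κ) (x , y)
    fullBit⁻ κ x y eq = x<y , ends x (inj-x x) , ends y (inj-y y) , full
      where
      P = prodF m (λ w → bit (fits (end x y w) (chosen x y w) (lookup κ w)))
      value : ∀ {t} → does (x <? y) ≡ t → (if t then P else 0) ≡ 1
      value refl = eq
      x<y = decidable-stable (x <? y) λ x≮y → case value (dec-false (x <? y) x≮y) of λ ()
      all : ∀ w → fits (end x y w) (chosen x y w) (lookup κ w) ≡ true
      all = prodF-bit⁻ m _ (value (dec-true (x <? y) x<y))
      inj-x : ∀ w → end w y w ≡ true
      inj-x w rewrite dec-true (w ≟ w) refl = refl
      inj-y : ∀ w → end x w w ≡ true
      inj-y w rewrite dec-true (w ≟ w) refl with does (w ≟ x)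
      ... | true = refl
      ... | false = refl
      ends : ∀ w → end x y w ≡ true → w ∈ zeros κ
      ends w e≡ with all w
      ... | p rewrite e≡ = ∈zeros⁺ κ w p
      full : Full e (zeros κ) x y
      full w w∈ w≢x w≢y with all w
      ... | p rewrite dec-false (w ≟ x) w≢x | dec-false (w ≟ y) w≢y | ∈zeros⁻ κ w w∈ with e x y w ≟ w
      ...   | yes q = q

    -- For `x ≢ y` this is the exponent m - 2 - m_xy of `b`, found by counting instead of truncated
    -- subtraction.
    rest : Fin m → Fin m → ℕ
    rest x y = countFin m (λ w → not (end x y w) ∧ not (chosen x y w))

    mult′ : ∀ x y → countFin m (λ w → not (end x y w) ∧ chosen x y w) ≡ mult e x y
    mult′ x y = countFin-cong m λ w → de-morgan (does (w ≟ x)) (does (w ≟ y)) (chosen x y w)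
      where
      de-morgan : ∀ p q c → not (p ∨ q) ∧ c ≡ not p ∧ not q ∧ c
      de-morgan true q c = refl
      de-morgan false q c = refl

    mult+rest : ∀ x y → x ≢ y → 2 + (mult e x y + rest x y) ≡ m
    mult+rest x y x≢y = trans
      (cong₂ (λ i j → i + (j + rest x y)) (sym two) (sym (mult′ x y)))
      (countFin-partition m (end x y) (chosen x y))
      where
      apart : ∀ w → does (w ≟ x) ∧ does (w ≟ y) ≡ false
      apart w with w ≟ x | w ≟ y
      ... | yes refl | yes refl = contradiction refl x≢y
      ... | yes _ | no _ = refl
      ... | no _ | _ = refl
      two : countFin m (end x y) ≡ 2
      two = trans (countFin-∨ m _ _ apart) (cong₂ _+_ (countFin-≟ m x) (countFin-≟ m y))

    fits-sum : ∀ s c → sumF a (bit ∘ fits s c) ≡ (if s then 1 else (if c then a else b))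
    fits-sum true c = cong ℕ.suc (trans (sumF-const b 0) (ℕ.*-zeroʳ b))
    fits-sum false true = cong ℕ.suc (trans (sumF-const b 1) (ℕ.*-identityʳ b))
    fits-sum false false = trans (sumF-const b 1) (ℕ.*-identityʳ b)

    -- With `a = r - 1` and `b = r - 2`, this is the term of the weight times (r-2)^(m-2), with
    -- denominators cleared.
    pairTerm : Fin m → Fin m → ℕ
    pairTerm x y = if does (x <? y) then a ^ mult e x y * b ^ rest x y else 0

    -- The rows are independent, so the numbers of fitting symbols multiply: 1 at an end, `a` where
    -- the triple chooses the pair, `b` elsewhere.
    sumL-fullBit : ∀ x y → sumL (λ κ → fullBit κ x y) (allWords a m) ≡ pairTerm x y
    sumL-fullBit x y with does (x <? y)
    ... | false = sumL-0 (allWords a m)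
    ... | true = begin
      sumL (λ κ → prodF m (λ w → bit (fits (end x y w) (chosen x y w) (lookup κ w)))) (allWords a m)
        ≡⟨ sumL-prodF a m (λ w v → bit (fits (end x y w) (chosen x y w) v)) ⟩
      prodF m (λ w → sumF a (bit ∘ fits (end x y w) (chosen x y w)))
        ≡⟨ prodF-cong m (λ w → fits-sum (end x y w) (chosen x y w)) ⟩
      prodF m (λ w → if end x y w then 1 else (if chosen x y w then a else b))
        ≡⟨ prodF-if m (end x y) (chosen x y) a b ⟩
      a ^ countFin m (λ w → not (end x y w) ∧ chosen x y w) * b ^ rest x y
        ≡⟨ cong (λ k → a ^ k * b ^ rest x y) (mult′ x y) ⟩
      a ^ mult e x y * b ^ rest x y ∎
      where open ≡-Reasoning

    scaledWeight : ℕ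
    scaledWeight = sumF m λ x → sumF m λ y → pairTerm x y

    pairs : List (Fin m × Fin m)
    pairs = cartesianProduct (allFin m) (allFin m)

    sumPairs : (Fin m → Fin m → ℕ) → ℕ
    sumPairs f = sumL (λ (x , y) → f x y) pairs

    sumPairs-sumF : ∀ f → sumPairs f ≡ sumF m λ x → sumF m λ y → f x y
    sumPairs-sumF f = trans (sumL-cartesianProductWith _ _,_ (allFin m) (allFin m))
      (trans (sumL-cong (λ x → sumL-allFin m (f x)) (allFin m)) (sumL-allFin m _))

    fullPairs : Word → List (Fin m × Fin m)
    fullPairs κ = filter (λ (x , y) → fullBit κ x y ℕ.≟ 1) pairs

    fullPairs-unique : ∀ κ → Unique (fullPairs κ)
    fullPairs-unique κ = Unique.filter⁺ _ (Unique.cartesianProduct⁺ (allFin⁺ m) (allFin⁺ m))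

    ∈-fullPairs⁻ : ∀ κ {q} → q L.∈ fullPairs κ → FullPair e (zeros κ) (zeros κ) q
    ∈-fullPairs⁻ κ {x , y} q∈ = fullBit⁻ κ x y (proj₂ (L.∈-filter⁻ (λ (x , y) → fullBit κ x y ℕ.≟ 1) {xs = pairs} q∈))

    ∈-fullPairs⁺ : ∀ κ {q} → FullPair e (zeros κ) (zeros κ) q → q L.∈ fullPairs κ
    ∈-fullPairs⁺ κ {x , y} full = L.∈-filter⁺ (λ (x , y) → fullBit κ x y ℕ.≟ 1)
      (L.∈-cartesianProduct⁺ (L.∈-allFin x) (L.∈-allFin y)) (fullBit⁺ κ x y full)

    length-fullPairs : ∀ κ → length (fullPairs κ) ≡ sumPairs (fullBit κ)
    length-fullPairs κ = length-filter-≟1 _ (λ (x , y) → fullBit≤1 κ x y) pairs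

    -- For the last summand, the sums over words and over pairs are exchanged, so that each pair
    -- counts the skeletons in which it is full.
    sum-local-bounds : sumL (λ κ → 1 + ∣ zeros κ ∣ + length (fullPairs κ)) (allWords a m) ≡
      a ^ m + m * a ^ (m ∸ 1) + scaledWeight
    sum-local-bounds = begin
      sumL (λ κ → 1 + ∣ zeros κ ∣ + length (fullPairs κ)) W
        ≡⟨ sumL-+ _ _ W ⟩
      sumL (λ κ → 1 + ∣ zeros κ ∣) W + sumL (λ κ → length (fullPairs κ)) W
        ≡⟨ cong₂ _+_ (trans (sumL-+ _ _ W) (cong₂ _+_ (sumL-1 a m) (sumL-∣zeros∣ b m)))
             (trans (sumL-cong length-fullPairs W) (sumL-swap (λ κ (x , y) → fullBit κ x y) W pairs)) ⟩
      a ^ m + m * a ^ (m ∸ 1) + sumPairs (λ x y → sumL (λ κ → fullBit κ x y) W)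
        ≡⟨ cong (a ^ m + m * a ^ (m ∸ 1) +_) (trans (sumL-cong (λ (x , y) → sumL-fullBit x y) pairs) (sumPairs-sumF pairTerm)) ⟩
      a ^ m + m * a ^ (m ∸ 1) + scaledWeight ∎
      where
      open ≡-Reasoning
      W = allWords a m

  -- The TCM defined by the types of the vertices

  module OddOneOut {m : ℕ} (h : Fin m → Fin m → Fin m → Bool) (h-sym : ∀ u v w → h u v w ≡ h v u w) where

    open Min (F.≤-totalOrder m) using (_⊓_; ⊓-comm; ⊓-assoc; ⊓-sel; x≤y⇒x⊓y≈x; x≤y⇒y⊓x≈x)

    -- The bits are the types of `u`, `v`, `w` in this order, the type of a vertex being `h` with
    -- that vertex in last place. The vertex in the minority is returned, and `t` if all types
    -- agree.
    pick : {A : Set} → Bool → Bool → Bool → A → A → A → A → A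
    pick true  true  true  u v w t = t
    pick false false false u v w t = t
    pick true  true  false u v w t = w
    pick false false true  u v w t = w
    pick true  false true  u v w t = v
    pick false true  false u v w t = v
    pick false true  true  u v w t = u
    pick true  false false u v w t = u

    least : Fin m → Fin m → Fin m → Fin m
    least u v w = u ⊓ (v ⊓ w)

    omit : TCMfun m
    omit u v w = pick (h v w u) (h u w v) (h u v w) u v w (least u v w)

    least-sel : ∀ u v w → (least u v w ≡ u) ⊎ (least u v w ≡ v) ⊎ (least u v w ≡ w)
    least-sel u v w with ⊓-sel u (v ⊓ w) | ⊓-sel v w
    ... | inj₁ p | _ = inj₁ p
    ... | inj₂ p | inj₁ q = inj₂ (inj₁ (trans p q))
    ... | inj₂ p | inj₂ q = inj₂ (inj₂ (trans p q))

    pick-sel : ∀ {A : Set} p q s {u v w t : A} → (t ≡ u) ⊎ (t ≡ v) ⊎ (t ≡ w) →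
      (pick p q s u v w t ≡ u) ⊎ (pick p q s u v w t ≡ v) ⊎ (pick p q s u v w t ≡ w)
    pick-sel true  true  true  sel = sel
    pick-sel false false false sel = sel
    pick-sel true  true  false _ = inj₂ (inj₂ refl)
    pick-sel false false true  _ = inj₂ (inj₂ refl)
    pick-sel true  false true  _ = inj₂ (inj₁ refl)
    pick-sel false true  false _ = inj₂ (inj₁ refl)
    pick-sel false true  true  _ = inj₁ refl
    pick-sel true  false false _ = inj₁ refl

    pick-swap₁₂ : ∀ {A : Set} p q s (u v w t : A) → pick p q s u v w t ≡ pick q p s v u w t
    pick-swap₁₂ true  true  true  u v w t = refl
    pick-swap₁₂ false false false u v w t = refl
    pick-swap₁₂ true  true  false u v w t = refl
    pick-swap₁₂ false false true  u v w t = refl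
    pick-swap₁₂ true  false true  u v w t = refl
    pick-swap₁₂ false true  false u v w t = refl
    pick-swap₁₂ false true  true  u v w t = refl
    pick-swap₁₂ true  false false u v w t = refl

    pick-swap₂₃ : ∀ {A : Set} p q s (u v w t : A) → pick p q s u v w t ≡ pick p s q u w v t
    pick-swap₂₃ true  true  true  u v w t = refl
    pick-swap₂₃ false false false u v w t = refl
    pick-swap₂₃ true  true  false u v w t = refl
    pick-swap₂₃ false false true  u v w t = refl
    pick-swap₂₃ true  false true  u v w t = refl
    pick-swap₂₃ false true  false u v w t = refl
    pick-swap₂₃ false true  true  u v w t = refl
    pick-swap₂₃ true  false false u v w t = refl

    omit-isTCM : IsTCM omit
    omit-isTCM u v w _ _ _ = pick-sel (h v w u) (h u w v) (h u v w) (least-sel u v w) , swap₁₂ , swap₂₃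
      where
      swap₁₂ : omit u v w ≡ omit v u w
      swap₁₂ rewrite h-sym v u w = trans (pick-swap₁₂ (h v w u) (h u w v) (h u v w) u v w (least u v w))
        (cong (pick (h u w v) (h v w u) (h u v w) v u w)
          (trans (sym (⊓-assoc u v w)) (trans (cong (_⊓ w) (⊓-comm u v)) (⊓-assoc v u w))))
      swap₂₃ : omit u v w ≡ omit u w v
      swap₂₃ rewrite h-sym w v u = trans (pick-swap₂₃ (h v w u) (h u w v) (h u v w) u v w (least u v w))
        (cong (λ t → pick (h v w u) (h u v w) (h u w v) u w v (u ⊓ t)) (⊓-comm v w))

    omit-minority : ∀ u v w → h v w u ≡ h u w v → h u v w ≢ h u w v → omit u v w ≡ w
    omit-minority u v w eq ne with h v w u | h u w v | h u v w
    ... | true  | true  | false = refl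
    ... | false | false | true = refl
    ... | true  | true  | true = contradiction refl ne
    ... | false | false | false = contradiction refl ne
    omit-minority u v w () ne | true | false | _
    omit-minority u v w () ne | false | true | _

    -- As `u` and `v` have the same type, either `w` is the odd vertex or all types agree and the
    -- tie goes to `w`.
    omit-least : ∀ u v w → h v w u ≡ h u w v → w < u → w < v → omit u v w ≡ w
    omit-least u v w eq w<u w<v with h v w u | h u w v | h u v w
    ... | true  | true  | false = refl
    ... | false | false | true = refl
    ... | true  | true  | true = least≡w
      where least≡w = trans (cong (u ⊓_) (x≤y⇒y⊓x≈x (ℕ.<⇒≤ w<v))) (x≤y⇒y⊓x≈x (ℕ.<⇒≤ w<u))
    ... | false | false | false = least≡w
      where least≡w = trans (cong (u ⊓_) (x≤y⇒y⊓x≈x (ℕ.<⇒≤ w<v))) (x≤y⇒y⊓x≈x (ℕ.<⇒≤ w<u))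
    omit-least u v w () _ _ | true | false | _
    omit-least u v w () _ _ | false | true | _

  -- Entries as a skeleton symbol and a bit

  private variable
    b : ℕ

  skel : Fin (2 + b) → Fin (1 + b)
  skel zero = zero
  skel (suc zero) = zero
  skel (suc (suc i)) = suc i

  isOne : Fin (2 + b) → Bool
  isOne (suc zero) = true
  isOne _ = false

  -- The bit is lost off the merged symbol, so a set of ones can be read back from its column only
  -- if it lies in `zeros` of the skeleton.
  entry : Fin (1 + b) → Bool → Fin (2 + b)
  entry zero false = zero
  entry zero true = suc zero
  entry (suc i) _ = suc (suc i)

  entry-skel-isOne : (v : Fin (2 + b)) → entry (skel v) (isOne v) ≡ v
  entry-skel-isOne zero = refl
  entry-skel-isOne (suc zero) = refl
  entry-skel-isOne (suc (suc i)) = refl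

  skel-entry : (i : Fin (1 + b)) (o : Bool) → skel (entry i o) ≡ i
  skel-entry zero false = refl
  skel-entry zero true = refl
  skel-entry (suc i) o = refl

  isOne⇒≡1 : (v : Fin (2 + b)) → isOne v ≡ true → v ≡ suc zero
  isOne⇒≡1 (suc zero) _ = refl
  isOne⇒≡1 zero ()
  isOne⇒≡1 (suc (suc _)) ()

  ¬isOne⇒≡0 : (v : Fin (2 + b)) → isZero (skel v) ≡ true → isOne v ≢ true → v ≡ zero
  ¬isOne⇒≡0 zero _ _ = refl
  ¬isOne⇒≡0 (suc zero) _ ne = contradiction refl ne

  isOne⇒isZero-skel : (v : Fin (2 + b)) → isOne v ≡ true → isZero (skel v) ≡ true
  isOne⇒isZero-skel v p rewrite isOne⇒≡1 v p = refl

  module _ {m : ℕ} (p : Fin m → Bool) where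

    ∈tabulate⁺ : ∀ {x} → p x ≡ true → x ∈ Vec.tabulate p
    ∈tabulate⁺ {x} eq = Vec.lookup⇒[]= x _ (trans (Vec.lookup∘tabulate p x) eq)

    ∈tabulate⁻ : ∀ {x} → x ∈ Vec.tabulate p → p x ≡ true
    ∈tabulate⁻ {x} x∈ = trans (sym (Vec.lookup∘tabulate p x)) (Vec.[]=⇒lookup x∈)

  -- The columns of a matrix avoiding M

  module Columns {m n : ℕ} (A : Matrix m n (2 + b)) (simple : Simple A) (avoids : ¬ ContainsConfig A M) where

    Has001 : Fin m → Fin m → Fin m → Fin n → Set
    Has001 u v w j = A u j ≡ zero × A v j ≡ zero × A w j ≡ suc zero

    has001? : ∀ u v w j → Dec (Has001 u v w j)
    has001? u v w j = (A u j F.≟ zero) ×-dec (A v j F.≟ zero) ×-dec (A w j F.≟ suc zero)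

    -- Occurrences are sought in the whole matrix, so the types, and with them the TCM, are the same
    -- for every skeleton.
    h : Fin m → Fin m → Fin m → Bool
    h u v w = does (any? (has001? u v w))

    h-sym : ∀ u v w → h u v w ≡ h v u w
    h-sym u v w = does-⇔ (mk⇔ swap swap) (any? (has001? u v w)) (any? (has001? v u w))
      where
      swap : ∀ {u v} → ∃ (Has001 u v w) → ∃ (Has001 v u w)
      swap (j , p , q , s) = j , q , p , s

    skeleton : Fin n → Vec (Fin (1 + b)) m
    skeleton j = Vec.tabulate (λ i → skel (A i j))

    ones : Fin n → Subset m
    ones j = Vec.tabulate (λ i → isOne (A i j))

    column-injective : ∀ {j k} → skeleton j ≡ skeleton k → ones j ≡ ones k → j ≡ k
    column-injective {j} {k} eq eq′ = simple j k λ i → begin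
      A i j                                     ≡⟨ entry-skel-isOne (A i j) ⟨
      entry (skel (A i j)) (isOne (A i j))      ≡⟨ cong₂ entry (tabulate-≡ eq i) (tabulate-≡ eq′ i) ⟩
      entry (skel (A i k)) (isOne (A i k))      ≡⟨ entry-skel-isOne (A i k) ⟩
      A i k ∎
      where
      open ≡-Reasoning
      tabulate-≡ : ∀ {C : Set} {f g : Fin m → C} → Vec.tabulate f ≡ Vec.tabulate g → ∀ i → f i ≡ g i
      tabulate-≡ {f = f} {g} eq i = trans (sym (Vec.lookup∘tabulate f i))
        (trans (cong (λ v → lookup v i) eq) (Vec.lookup∘tabulate g i))

    -- For `lo`, column `j` itself is an occurrence of 0,0,1. For `hi`, a column `k` with 0,0,1 on
    -- rows where `j` has 1,1,0 would form `M` together with `j`.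
    allowed : ∀ j → Allowed h (zeros (skeleton j)) (ones j)
    allowed j = record { sub = sub′ ; lo = lo′ ; hi = hi′ }
      where
      U = zeros (skeleton j)
      O = ones j
      sub′ : O ⊆ U
      sub′ {x} x∈ = ∈zeros⁺ (skeleton j) x (trans (cong isZero (Vec.lookup∘tabulate _ x))
        (isOne⇒isZero-skel (A x j) (∈tabulate⁻ _ x∈)))
      one : ∀ {x} → x ∈ O → A x j ≡ suc zero
      one {x} x∈ = isOne⇒≡1 (A x j) (∈tabulate⁻ _ x∈)
      nil : ∀ {x} → x ∈ U → x ∉ O → A x j ≡ zero
      nil {x} x∈ x∉ = ¬isOne⇒≡0 (A x j)
        (trans (cong isZero (sym (Vec.lookup∘tabulate _ x))) (∈zeros⁻ (skeleton j) x x∈)) (x∉ ∘ ∈tabulate⁺ _)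
      lo′ : ∀ {u v w} → u ∈ U → v ∈ U → w ∈ U → u ≢ v → u ∉ O → v ∉ O → w ∈ O → h u v w ≡ true
      lo′ {u} {v} {w} u∈ v∈ w∈ _ u∉ v∉ w∈O = dec-true (any? (has001? u v w)) (j , nil u∈ u∉ , nil v∈ v∉ , one w∈O)
      hi′ : ∀ {u v w} → u ∈ U → v ∈ U → w ∈ U → u ≢ v → u ∈ O → v ∈ O → w ∉ O → h u v w ≡ false
      hi′ {u} {v} {w} u∈ v∈ w∈ u≢v u∈O v∈O w∉ = dec-false (any? (has001? u v w)) no-001
        where
        no-001 : ¬ ∃ (Has001 u v w)
        no-001 (k , uk , vk , wk) = avoids (ρ , κ , (λ {i} {j} → ρ-inj {i} {j}) , (λ {i} {j} → κ-inj {i} {j}) , entries)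
          where
          ρ : Fin 3 → Fin m
          ρ zero = u
          ρ (suc zero) = v
          ρ (suc (suc _)) = w
          κ : Fin 2 → Fin n
          κ zero = k
          κ (suc _) = j
          u≢w : u ≢ w
          u≢w refl = w∉ u∈O
          v≢w : v ≢ w
          v≢w refl = w∉ v∈O
          k≢j : k ≢ j
          k≢j refl = case trans (sym uk) (one u∈O) of λ ()
          ρ-inj : Injective _≡_ _≡_ ρ
          ρ-inj {zero} {zero} _ = refl
          ρ-inj {zero} {suc zero} eq = contradiction eq u≢v
          ρ-inj {zero} {suc (suc zero)} eq = contradiction eq u≢w
          ρ-inj {suc zero} {zero} eq = contradiction (sym eq) u≢v
          ρ-inj {suc zero} {suc zero} _ = refl
          ρ-inj {suc zero} {suc (suc zero)} eq = contradiction eq v≢w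
          ρ-inj {suc (suc zero)} {zero} eq = contradiction (sym eq) u≢w
          ρ-inj {suc (suc zero)} {suc zero} eq = contradiction (sym eq) v≢w
          ρ-inj {suc (suc zero)} {suc (suc zero)} _ = refl
          κ-inj : Injective _≡_ _≡_ κ
          κ-inj {zero} {zero} _ = refl
          κ-inj {zero} {suc zero} eq = contradiction eq k≢j
          κ-inj {suc zero} {zero} eq = contradiction (sym eq) k≢j
          κ-inj {suc zero} {suc zero} _ = refl
          entries : ∀ i c → toℕ (A (ρ i) (κ c)) ≡ M i c
          entries zero zero = cong toℕ uk
          entries zero (suc _) = cong toℕ (one u∈O)
          entries (suc zero) zero = cong toℕ vk
          entries (suc zero) (suc _) = cong toℕ (one v∈O)
          entries (suc (suc _)) zero = cong toℕ wk
          entries (suc (suc _)) (suc _) = cong toℕ (nil w∈ w∉)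

    open OddOneOut h h-sym public using (omit; omit-isTCM; omit-minority; omit-least)
    open PairSums b omit

    fibre : Word → List (Fin n)
    fibre κ = filter (λ j → Vec.≡-dec F._≟_ (skeleton j) κ) (allFin n)

    ∈-fibre⁻ : ∀ {κ j} → j L.∈ fibre κ → skeleton j ≡ κ
    ∈-fibre⁻ {κ} j∈ = proj₂ (L.∈-filter⁻ (λ j → Vec.≡-dec F._≟_ (skeleton j) κ) {xs = allFin n} j∈)

    -- Columns with a common skeleton are told apart by their ones, so `UpperCore.bound` applies to
    -- these sets. The pairs it returns are distinct and full, hence at most as many as
    -- `fullPairs κ`.
    fibre-bound : ∀ κ → length (fibre κ) ≤ 1 + ∣ zeros κ ∣ + length (fullPairs κ)
    fibre-bound κ with UpperCore.bound (zeros κ) h omit omit-minority omit-least (map ones (fibre κ))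
        (unique-map⁺ ones (λ j∈ k∈ eq → column-injective (trans (∈-fibre⁻ j∈) (sym (∈-fibre⁻ k∈))) eq) (Unique.filter⁺ _ (allFin⁺ n)))
        ok (sub ∘ ok)
      where
      ok : ∀ {O} → O L.∈ map ones (fibre κ) → Allowed h (zeros κ) O
      ok O∈ with L.∈-map⁻ ones O∈
      ... | j , j∈ , refl = subst (λ κ → Allowed h (zeros κ) (ones j)) (∈-fibre⁻ j∈) (allowed j)
    ... | Q , uQ , fQ , le = begin
      length (fibre κ)                           ≡⟨ length-map ones (fibre κ) ⟨
      length (map ones (fibre κ))                ≤⟨ le ⟩
      1 + ∣ zeros κ ∣ + length Q                 ≤⟨ ℕ.+-monoʳ-≤ (1 + ∣ zeros κ ∣)
                                                      (unique-⊆⇒length≤ uQ (∈-fullPairs⁺ κ ∘ All.lookup fQ)) ⟩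
      1 + ∣ zeros κ ∣ + length (fullPairs κ) ∎
      where open ℕ.≤-Reasoning

    column-bound : n ≤ a ^ m + m * a ^ (m ∸ 1) + scaledWeight
    column-bound = begin
      n                                                                         ≡⟨ length-tabulate {n = n} (λ j → j) ⟨
      length (allFin n)                                                         ≤⟨ length≤∑fibres (Vec.≡-dec F._≟_) skeleton (allFin n) (allWords a m) (∈-allWords ∘ skeleton) ⟩
      sumL (length ∘ fibre) (allWords a m)                                      ≤⟨ sumL-mono fibre-bound (allWords a m) ⟩
      sumL (λ κ → 1 + ∣ zeros κ ∣ + length (fullPairs κ)) (allWords a m)       ≡⟨ sum-local-bounds ⟩
      a ^ m + m * a ^ (m ∸ 1) + scaledWeight ∎
      where open ℕ.≤-Reasoning

  -- The matrix built from a 2-recursive TCM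

  unique-lookup-injective : {A : Set} {xs : List A} → Unique xs → ∀ {i j} → List.lookup xs i ≡ List.lookup xs j → i ≡ j
  unique-lookup-injective (x∉ ∷ u) {zero} {zero} _ = refl
  unique-lookup-injective (x∉ ∷ u) {zero} {suc j} eq = contradiction eq (All.lookup x∉ (L.∈-lookup j))
  unique-lookup-injective (x∉ ∷ u) {suc i} {zero} eq = contradiction (sym eq) (All.lookup x∉ (L.∈-lookup i))
  unique-lookup-injective (x∉ ∷ u) {suc i} {suc j} eq = cong suc (unique-lookup-injective u eq)

  module Construction (b : ℕ) {m : ℕ} (e : TCMfun m) (tcm : IsTCM e) (rec2 : Rec2 e ⊤) where

    open PairSums b e
    open LowerCore e tcm

    column : Word → Subset m → Vec (Fin (2 + b)) m
    column κ O = Vec.zipWith entry κ O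

    column-skel : ∀ κ O → Vec.map skel (column κ O) ≡ κ
    column-skel κ O = go κ O
      where
      go : ∀ {m} (κ : Vec (Fin a) m) (O : Vec Bool m) → Vec.map skel (Vec.zipWith entry κ O) ≡ κ
      go [] [] = refl
      go (i ∷ κ) (o ∷ O) = cong₂ _∷_ (skel-entry i o) (go κ O)

    lookup-column : ∀ κ O x → lookup (column κ O) x ≡ entry (lookup κ x) (lookup O x)
    lookup-column κ O x = Vec.lookup-zipWith entry x κ O

    column-one⁺ : ∀ κ O {x} → x ∈ zeros κ → x ∈ O → lookup (column κ O) x ≡ suc zero
    column-one⁺ κ O {x} x∈ x∈O with lookup κ x | ∈zeros⁻ κ x x∈ | lookup-column κ O x
    ... | zero | _ | eq = trans eq (cong (entry zero) (Vec.[]=⇒lookup x∈O))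

    column-01 : ∀ κ O {x} → toℕ (lookup (column κ O) x) ≤ 1 → x ∈ zeros κ
    column-01 κ O {x} le = ∈zeros⁺ κ x (go (lookup κ x) (lookup O x) (subst (λ v → toℕ v ≤ 1) (lookup-column κ O x) le))
      where
      go : ∀ i o → toℕ (entry {b} i o) ≤ 1 → isZero i ≡ true
      go zero _ _ = refl
      go (suc i) _ (s≤s ())

    column-0⇒∉ : ∀ κ O {x} → toℕ (lookup (column κ O) x) ≡ 0 → x ∉ O
    column-0⇒∉ κ O {x} eq x∈O = case trans (sym (cong toℕ (column-one⁺ κ O (column-01 κ O (subst (_≤ 1) (sym eq) z≤n)) x∈O))) eq of λ ()

    column-1⇒∈ : ∀ κ O {x} → toℕ (lookup (column κ O) x) ≡ 1 → x ∈ O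
    column-1⇒∈ κ O {x} eq = Vec.lookup⇒[]= x O (go (lookup κ x) (lookup O x) (trans (cong toℕ (sym (lookup-column κ O x))) eq))
      where
      go : ∀ i o → toℕ (entry {b} i o) ≡ 1 → o ≡ true
      go zero true _ = refl
      go zero false ()
      go (suc i) _ ()

    abstract
      sets : ∀ κ → Many (sep rec2) (zeros κ) (fullPairs κ)
      sets κ = many rec2 (zeros κ) ⊆⊤ (fullPairs κ) (fullPairs-unique κ) (All.tabulate (∈-fullPairs⁻ κ))

    columnsOver : Word → List (Vec (Fin (2 + b)) m)
    columnsOver κ = map (column κ) (proj₁ (sets κ))

    columns : List (Vec (Fin (2 + b)) m)
    columns = concatMap columnsOver (allWords a m)

    columnsOver-unique : ∀ κ → Unique (columnsOver κ)
    columnsOver-unique κ = let L , uL , ok , _ = sets κ in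
      unique-map⁺ (column κ) (λ O∈ O′∈ eq → ⊆-antisym (incl (ok O∈) eq) (incl (ok O′∈) (sym eq))) uL
      where
      incl : ∀ {O O′} → Allowed (sep rec2) (zeros κ) O → column κ O ≡ column κ O′ → O ⊆ O′
      incl {O} {O′} al eq {x} x∈ = column-1⇒∈ κ O′ (cong toℕ (trans (cong (λ c → lookup c x) (sym eq)) (column-one⁺ κ O (sub al x∈) x∈)))

    -- `skel` recovers the word from a column, so the lists over different words are disjoint.
    columns-unique : Unique columns
    columns-unique = unique-concatMap⁺ columnsOver columnsOver-unique same-skeleton (allWords-unique a m)
      where
      same-skeleton : ∀ {κ κ′ c} → c L.∈ columnsOver κ → c L.∈ columnsOver κ′ → κ ≡ κ′
      same-skeleton {κ} {κ′} c∈ c∈′ with L.∈-map⁻ (column κ) c∈ | L.∈-map⁻ (column κ′) c∈′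
      ... | O , _ , p | O′ , _ , q = trans (sym (column-skel κ O))
            (trans (cong (Vec.map skel) (trans (sym p) q)) (column-skel κ′ O′))

    columns-length : a ^ m + m * a ^ (m ∸ 1) + scaledWeight ≤ length columns
    columns-length = begin
      a ^ m + m * a ^ (m ∸ 1) + scaledWeight                                ≡⟨ sum-local-bounds ⟨
      sumL (λ κ → 1 + ∣ zeros κ ∣ + length (fullPairs κ)) (allWords a m)   ≤⟨ sumL-mono over (allWords a m) ⟩
      sumL (length ∘ columnsOver) (allWords a m)                            ≡⟨ length-concatMap columnsOver (allWords a m) ⟨
      length columns ∎
      where
      open ℕ.≤-Reasoning
      over : ∀ κ → 1 + ∣ zeros κ ∣ + length (fullPairs κ) ≤ length (columnsOver κ)
      over κ = ℕ.≤-trans (proj₂ (proj₂ (proj₂ (sets κ)))) (ℕ.≤-reflexive (sym (length-map (column κ) (proj₁ (sets κ)))))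

    matrix : Matrix m (length columns) (2 + b)
    matrix i j = lookup (List.lookup columns j) i

    matrix-simple : Simple matrix
    matrix-simple j k eq = unique-lookup-injective columns-unique (lookup-ext eq)
      where
      lookup-ext : ∀ {xs ys : Vec (Fin (2 + b)) m} → (∀ i → lookup xs i ≡ lookup ys i) → xs ≡ ys
      lookup-ext {xs} {ys} p = trans (sym (Vec.tabulate∘lookup xs)) (trans (Vec.tabulate-cong p) (Vec.tabulate∘lookup ys))

    column-data : ∀ {c} → c L.∈ columns → ∃ λ κ → ∃ λ O → c ≡ column κ O × Allowed (sep rec2) (zeros κ) O
    column-data c∈ with L.find (L.∈-concatMap⁻ columnsOver {xs = allWords a m} c∈)
    ... | κ , _ , c∈κ with L.∈-map⁻ (column κ) c∈κ
    ...   | O , O∈ , eq = κ , O , eq , proj₁ (proj₂ (proj₂ (sets κ))) O∈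

    -- The two columns may have different skeletons, but both obey the same `sep rec2`. One shows
    -- 0,0,1 and the other 1,1,0 on the same rows, which would make its value both `true` and
    -- `false`.
    matrix-avoids : ¬ ContainsConfig matrix M
    matrix-avoids (ρ , σ , ρ-inj , _ , entries)
      with column-data (L.∈-lookup {xs = columns} (σ zero)) | column-data (L.∈-lookup {xs = columns} (σ (suc zero)))
    ... | κ , O , c≡ , al | κ′ , O′ , c′≡ , al′ =
      case trans (sym (lo al (in-U r₀) (in-U r₁) (in-U r₂) u≢v (out r₀ refl) (out r₁ refl) (inn r₂ refl)))
                 (hi al′ (in-U′ r₀) (in-U′ r₁) (in-U′ r₂) u≢v (inn′ r₀ refl) (inn′ r₁ refl) (out′ r₂ refl)) of λ ()
      where
      r₀ r₁ r₂ : Fin 3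
      r₀ = zero
      r₁ = suc zero
      r₂ = suc (suc zero)
      u≢v : ρ r₀ ≢ ρ r₁
      u≢v eq = case ρ-inj eq of λ ()
      -- Entries 0 and 1 occur only under the merged symbol, which places the three rows in both
      -- `zeros κ` and `zeros κ′`.
      M≤1 : ∀ i j → M i j ≤ 1
      M≤1 zero zero = z≤n
      M≤1 zero (suc _) = s≤s z≤n
      M≤1 (suc zero) zero = z≤n
      M≤1 (suc zero) (suc _) = s≤s z≤n
      M≤1 (suc (suc _)) zero = s≤s z≤n
      M≤1 (suc (suc _)) (suc _) = z≤n
      value : ∀ i → toℕ (lookup (column κ O) (ρ i)) ≡ M i zero
      value i = trans (cong (λ c → toℕ (lookup c (ρ i))) (sym c≡)) (entries i zero)
      value′ : ∀ i → toℕ (lookup (column κ′ O′) (ρ i)) ≡ M i (suc zero)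
      value′ i = trans (cong (λ c → toℕ (lookup c (ρ i))) (sym c′≡)) (entries i (suc zero))
      in-U : ∀ i → ρ i ∈ zeros κ
      in-U i = column-01 κ O (subst (_≤ 1) (sym (value i)) (M≤1 i zero))
      in-U′ : ∀ i → ρ i ∈ zeros κ′
      in-U′ i = column-01 κ′ O′ (subst (_≤ 1) (sym (value′ i)) (M≤1 i (suc zero)))
      out : ∀ i → M i zero ≡ 0 → ρ i ∉ O
      out i p = column-0⇒∉ κ O (trans (value i) p)
      inn : ∀ i → M i zero ≡ 1 → ρ i ∈ O
      inn i p = column-1⇒∈ κ O (trans (value i) p)
      out′ : ∀ i → M i (suc zero) ≡ 0 → ρ i ∉ O′
      out′ i p = column-0⇒∉ κ′ O′ (trans (value′ i) p)
      inn′ : ∀ i → M i (suc zero) ≡ 1 → ρ i ∈ O′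
      inn′ i p = column-1⇒∈ κ′ O′ (trans (value′ i) p)

open Combinatorics
open import Data.Bool using (if_then_else_)
open import Data.Fin using (Fin; zero; suc; _<_; _<?_)
import Data.Fin.Properties as F
import Data.Integer as ℤ
import Data.Integer.Properties as ℤ
open import Data.Integer using (+_)
open import Data.List using (length)
open import Data.Nat using (ℕ; _∸_; _≤_)
open import Data.Nat as ℕ using (z≤n; s≤s)
import Data.Nat.Properties as ℕ
open import Data.Product using (_×_)
open import Data.Product using (_,_)
open import Data.Rational using (ℚ; _+_; _*_; _-_)
open import Data.Rational as ℚ using (0ℚ; 1ℚ; -_; _/_; toℚᵘ; NonNegative)
import Data.Rational.Properties as ℚ
open import Data.Rational.Solver using (module +-*-Solver)
open import Data.Rational.Unnormalised as ℚᵘ using (mkℚᵘ; *≡*; *≤*)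
import Data.Rational.Unnormalised.Properties as ℚᵘ
open import Function using (_∘_)
open import Relation.Binary.PropositionalEquality
open import Relation.Nullary using (Dec; yes; no; does)
open import Algebra.Bundles using (module CommutativeMonoid)
import Algebra.Properties.CommutativeSemigroup (CommutativeMonoid.commutativeSemigroup ℚ.*-1-commutativeMonoid) as ℚ*

-- From natural to rational numbers

toℚᵘ-/ : ∀ n d → toℚᵘ (+ n / ℕ.suc d) ℚᵘ.≃ mkℚᵘ (+ n) d
toℚᵘ-/ n d = ℚ.toℚᵘ-fromℚᵘ (mkℚᵘ (+ n) d)

ℕ→ℚ-+ : ∀ m n → ℕ→ℚ (m ℕ.+ n) ≡ ℕ→ℚ m + ℕ→ℚ n
ℕ→ℚ-+ m n = ℚ.toℚᵘ-injective (begin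
  toℚᵘ (ℕ→ℚ (m ℕ.+ n))                 ≈⟨ toℚᵘ-/ (m ℕ.+ n) 0 ⟩
  mkℚᵘ (+ (m ℕ.+ n)) 0                   ≈⟨ *≡* (cong (ℤ._* + 1) (sym (cong₂ ℤ._+_ (ℤ.*-identityʳ (+ m)) (ℤ.*-identityʳ (+ n))))) ⟩
  mkℚᵘ (+ m) 0 ℚᵘ.+ mkℚᵘ (+ n) 0         ≈⟨ ℚᵘ.+-cong (toℚᵘ-/ m 0) (toℚᵘ-/ n 0) ⟨
  toℚᵘ (ℕ→ℚ m) ℚᵘ.+ toℚᵘ (ℕ→ℚ n)       ≈⟨ ℚ.toℚᵘ-homo-+ (ℕ→ℚ m) (ℕ→ℚ n) ⟨
  toℚᵘ (ℕ→ℚ m + ℕ→ℚ n) ∎)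
  where open ℚᵘ.≃-Reasoning

ℕ→ℚ-* : ∀ m n → ℕ→ℚ (m ℕ.* n) ≡ ℕ→ℚ m * ℕ→ℚ n
ℕ→ℚ-* m n = ℚ.toℚᵘ-injective (begin
  toℚᵘ (ℕ→ℚ (m ℕ.* n))                 ≈⟨ toℚᵘ-/ (m ℕ.* n) 0 ⟩
  mkℚᵘ (+ (m ℕ.* n)) 0                   ≈⟨ *≡* (cong (ℤ._* + 1) (ℤ.pos-* m n)) ⟩
  mkℚᵘ (+ m) 0 ℚᵘ.* mkℚᵘ (+ n) 0         ≈⟨ ℚᵘ.*-cong (toℚᵘ-/ m 0) (toℚᵘ-/ n 0) ⟨
  toℚᵘ (ℕ→ℚ m) ℚᵘ.* toℚᵘ (ℕ→ℚ n)       ≈⟨ ℚ.toℚᵘ-homo-* (ℕ→ℚ m) (ℕ→ℚ n) ⟨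
  toℚᵘ (ℕ→ℚ m * ℕ→ℚ n) ∎)
  where open ℚᵘ.≃-Reasoning

-- Used in the form that α times r - 2 is r - 1.
/-*-cancel : ∀ n d → (+ n / ℕ.suc d) * ℕ→ℚ (ℕ.suc d) ≡ ℕ→ℚ n
/-*-cancel n d = ℚ.toℚᵘ-injective (begin
  toℚᵘ ((+ n / ℕ.suc d) * ℕ→ℚ (ℕ.suc d))            ≈⟨ ℚ.toℚᵘ-homo-* (+ n / ℕ.suc d) (ℕ→ℚ (ℕ.suc d)) ⟩
  toℚᵘ (+ n / ℕ.suc d) ℚᵘ.* toℚᵘ (ℕ→ℚ (ℕ.suc d))    ≈⟨ ℚᵘ.*-cong (toℚᵘ-/ n d) (toℚᵘ-/ (ℕ.suc d) 0) ⟩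
  mkℚᵘ (+ n) d ℚᵘ.* mkℚᵘ (+ ℕ.suc d) 0               ≈⟨ *≡* (trans (ℤ.*-identityʳ _) (cong (λ k → + n ℤ.* + ℕ.suc k) (sym (ℕ.*-identityʳ d)))) ⟩
  mkℚᵘ (+ n) 0                                        ≈⟨ toℚᵘ-/ n 0 ⟨
  toℚᵘ (ℕ→ℚ n) ∎)
  where open ℚᵘ.≃-Reasoning

ℕ→ℚ-mono-≤ : ∀ {m n} → m ℕ.≤ n → ℕ→ℚ m ℚ.≤ ℕ→ℚ n
ℕ→ℚ-mono-≤ {m} {n} m≤n = ℚ.toℚᵘ-cancel-≤ (begin
  toℚᵘ (ℕ→ℚ m)   ≃⟨ toℚᵘ-/ m 0 ⟩
  mkℚᵘ (+ m) 0    ≤⟨ *≤* (ℤ.*-monoʳ-≤-nonNeg (+ 1) (ℤ.+≤+ m≤n)) ⟩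
  mkℚᵘ (+ n) 0    ≃⟨ toℚᵘ-/ n 0 ⟨
  toℚᵘ (ℕ→ℚ n) ∎)
  where open ℚᵘ.≤-Reasoning

ℕ→ℚ-^ : ∀ n k → ℕ→ℚ (n ℕ.^ k) ≡ ℕ→ℚ n ^ℚ k
ℕ→ℚ-^ n ℕ.zero = refl
ℕ→ℚ-^ n (ℕ.suc k) = trans (ℕ→ℚ-* n (n ℕ.^ k)) (cong (ℕ→ℚ n *_) (ℕ→ℚ-^ n k))

^ℚ-+ : ∀ q j k → q ^ℚ (j ℕ.+ k) ≡ q ^ℚ j * q ^ℚ k
^ℚ-+ q ℕ.zero k = sym (ℚ.*-identityˡ _)
^ℚ-+ q (ℕ.suc j) k = trans (cong (q *_) (^ℚ-+ q j k)) (sym (ℚ.*-assoc q _ _))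

^ℚ-* : ∀ p q k → (p * q) ^ℚ k ≡ p ^ℚ k * q ^ℚ k
^ℚ-* p q ℕ.zero = sym (ℚ.*-identityˡ 1ℚ)
^ℚ-* p q (ℕ.suc k) = trans (cong (p * q *_) (^ℚ-* p q k)) (ℚ*.interchange p q _ _)

sumℚ-cong : ∀ n {f g : Fin n → ℚ} → (∀ i → f i ≡ g i) → sumℚ n f ≡ sumℚ n g
sumℚ-cong ℕ.zero _ = refl
sumℚ-cong (ℕ.suc n) eq = cong₂ _+_ (eq zero) (sumℚ-cong n (eq ∘ suc))

sumℚ-*ʳ : ∀ n (f : Fin n → ℚ) c → sumℚ n f * c ≡ sumℚ n (λ i → f i * c)
sumℚ-*ʳ ℕ.zero f c = ℚ.*-zeroˡ c
sumℚ-*ʳ (ℕ.suc n) f c = trans (ℚ.*-distribʳ-+ c (f zero) _) (cong (λ t → f zero * c + t) (sumℚ-*ʳ n (f ∘ suc) c))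

ℕ→ℚ-sumF : ∀ n (f : Fin n → ℕ) → ℕ→ℚ (sumF n f) ≡ sumℚ n (ℕ→ℚ ∘ f)
ℕ→ℚ-sumF ℕ.zero f = refl
ℕ→ℚ-sumF (ℕ.suc n) f = trans (ℕ→ℚ-+ (f zero) _) (cong (λ t → ℕ→ℚ (f zero) + t) (ℕ→ℚ-sumF n (f ∘ suc)))

module _ (k : ℕ) {m : ℕ} (e : TCMfun m) where

  open PairSums (ℕ.suc k) e

  private
    α = alphaR (3 ℕ.+ k)
    β = ℕ→ℚ (ℕ.suc k)
    c = β ^ℚ (m ∸ 2)

  -- By `mult+rest` the exponent `m ∸ 2` is `μ` plus `ρ`. The first `μ` factors `β` turn the power
  -- of `α` into one of `a`, and `ρ` factors remain.
  scaled-term : ∀ x y → x < y → α ^ℚ mult e x y * c ≡ ℕ→ℚ (a ℕ.^ mult e x y ℕ.* ℕ.suc k ℕ.^ rest x y)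
  scaled-term x y x<y = begin
    α ^ℚ μ * β ^ℚ (m ∸ 2)                          ≡⟨ cong (λ j → α ^ℚ μ * β ^ℚ (j ∸ 2)) (mult+rest x y (F.<⇒≢ x<y)) ⟨
    α ^ℚ μ * β ^ℚ (μ ℕ.+ ρ)                        ≡⟨ cong (α ^ℚ μ *_) (^ℚ-+ β μ ρ) ⟩
    α ^ℚ μ * (β ^ℚ μ * β ^ℚ ρ)                     ≡⟨ ℚ.*-assoc (α ^ℚ μ) (β ^ℚ μ) (β ^ℚ ρ) ⟨
    α ^ℚ μ * β ^ℚ μ * β ^ℚ ρ                       ≡⟨ cong (_* β ^ℚ ρ) (^ℚ-* α β μ) ⟨
    (α * β) ^ℚ μ * β ^ℚ ρ                          ≡⟨ cong (λ q → q ^ℚ μ * β ^ℚ ρ) (/-*-cancel a k) ⟩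
    ℕ→ℚ a ^ℚ μ * β ^ℚ ρ                            ≡⟨ cong₂ _*_ (ℕ→ℚ-^ a μ) (ℕ→ℚ-^ (ℕ.suc k) ρ) ⟨
    ℕ→ℚ (a ℕ.^ μ) * ℕ→ℚ (ℕ.suc k ℕ.^ ρ)           ≡⟨ ℕ→ℚ-* (a ℕ.^ μ) (ℕ.suc k ℕ.^ ρ) ⟨
    ℕ→ℚ (a ℕ.^ μ ℕ.* ℕ.suc k ℕ.^ ρ) ∎
    where
    open ≡-Reasoning
    μ = mult e x y
    ρ = rest x y

  scaled-pair : ∀ x y → (if does (x <? y) then α ^ℚ mult e x y else 0ℚ) * c ≡ ℕ→ℚ (pairTerm x y)
  scaled-pair x y = go (x <? y) refl
    where
    go : (d : Dec (x < y)) → does (x <? y) ≡ does d →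
      (if does (x <? y) then α ^ℚ mult e x y else 0ℚ) * c ≡ ℕ→ℚ (pairTerm x y)
    go (yes x<y) eq rewrite eq = scaled-term x y x<y
    go (no _) eq rewrite eq = ℚ.*-zeroˡ c

  -- For `m ≤ 1` there is no pair and both sides vanish, so the truncation in `m ∸ 2` does no harm.
  weight-scaled : weight α e * c ≡ ℕ→ℚ scaledWeight
  weight-scaled = begin
    weight α e * c                                     ≡⟨ sumℚ-*ʳ m _ c ⟩
    sumℚ m (λ x → sumℚ m (λ y → if does (x <? y) then α ^ℚ mult e x y else 0ℚ) * c)
      ≡⟨ sumℚ-cong m (λ x → trans (sumℚ-*ʳ m _ c) (sumℚ-cong m (scaled-pair x))) ⟩
    sumℚ m (λ x → sumℚ m (λ y → ℕ→ℚ (pairTerm x y)))   ≡⟨ sumℚ-cong m (λ x → ℕ→ℚ-sumF m (pairTerm x)) ⟨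
    sumℚ m (λ x → ℕ→ℚ (sumF m (pairTerm x)))            ≡⟨ ℕ→ℚ-sumF m _ ⟨
    ℕ→ℚ scaledWeight ∎
    where open ≡-Reasoning

p+q+s-p-q≡s : ∀ p q s → p + q + s - p - q ≡ s
p+q+s-p-q≡s = solve 3 (λ p q s → p :+ q :+ s :- p :- q := s) refl
  where
  open +-*-Solver

nonNegative-ℕ→ℚ^ : ∀ n k → NonNegative (ℕ→ℚ n ^ℚ k)
nonNegative-ℕ→ℚ^ n k = subst NonNegative (ℕ→ℚ-^ n k) (ℚ.nonNegative (ℕ→ℚ-mono-≤ {0} {n ℕ.^ k} z≤n))

module _ (m a w : ℕ) where

  private
    P = ℕ→ℚ a ^ℚ m
    Q = ℕ→ℚ m * (ℕ→ℚ a ^ℚ (m ∸ 1))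
    total = a ℕ.^ m ℕ.+ m ℕ.* a ℕ.^ (m ∸ 1) ℕ.+ w

  total-excess : ℕ→ℚ total - P - Q ≡ ℕ→ℚ w
  total-excess = trans (cong (λ t → t - P - Q) cast) (p+q+s-p-q≡s P Q (ℕ→ℚ w))
    where
    open ≡-Reasoning
    cast : ℕ→ℚ total ≡ P + Q + ℕ→ℚ w
    cast = begin
      ℕ→ℚ total                                                            ≡⟨ ℕ→ℚ-+ (a ℕ.^ m ℕ.+ m ℕ.* a ℕ.^ (m ∸ 1)) w ⟩
      ℕ→ℚ (a ℕ.^ m ℕ.+ m ℕ.* a ℕ.^ (m ∸ 1)) + ℕ→ℚ w                      ≡⟨ cong (_+ ℕ→ℚ w) (ℕ→ℚ-+ (a ℕ.^ m) _) ⟩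
      ℕ→ℚ (a ℕ.^ m) + ℕ→ℚ (m ℕ.* a ℕ.^ (m ∸ 1)) + ℕ→ℚ w                  ≡⟨ cong (λ t → ℕ→ℚ (a ℕ.^ m) + t + ℕ→ℚ w) (ℕ→ℚ-* m _) ⟩
      ℕ→ℚ (a ℕ.^ m) + ℕ→ℚ m * ℕ→ℚ (a ℕ.^ (m ∸ 1)) + ℕ→ℚ w               ≡⟨ cong₂ (λ s t → s + ℕ→ℚ m * t + ℕ→ℚ w) (ℕ→ℚ-^ a m) (ℕ→ℚ-^ a (m ∸ 1)) ⟩
      P + Q + ℕ→ℚ w ∎

  excess-mono : ∀ {f g} → f ℕ.≤ g → ℕ→ℚ f - P - Q ℚ.≤ ℕ→ℚ g - P - Q
  excess-mono f≤g = ℚ.+-monoˡ-≤ (- Q) (ℚ.+-monoˡ-≤ (- P) (ℕ→ℚ-mono-≤ f≤g))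

  excess-≤ : ∀ {f} → f ℕ.≤ total → ℕ→ℚ f - P - Q ℚ.≤ ℕ→ℚ w
  excess-≤ f≤ = ℚ.≤-trans (excess-mono f≤) (ℚ.≤-reflexive total-excess)

  excess-≥ : ∀ {f} → total ℕ.≤ f → ℕ→ℚ w ℚ.≤ ℕ→ℚ f - P - Q
  excess-≥ ≤f = ℚ.≤-trans (ℚ.≤-reflexive (sym total-excess)) (excess-mono ≤f)

-- The two inequalities

upper : ∀ m k f h → IsForbM m (3 ℕ.+ k) f → IsH m (alphaR (3 ℕ.+ k)) h →
  ℕ→ℚ f - ℕ→ℚ (2 ℕ.+ k) ^ℚ m - ℕ→ℚ m * (ℕ→ℚ (2 ℕ.+ k) ^ℚ (m ∸ 1)) ℚ.≤ h * ℕ→ℚ (1 ℕ.+ k) ^ℚ (m ∸ 2)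
upper m k f h ((A , simple , avoids) , _) (_ , h-max) = ℚ.≤-trans
  (excess-≤ m (2 ℕ.+ k) scaledWeight column-bound)
  (ℚ.≤-trans (ℚ.≤-reflexive (sym (weight-scaled k omit)))
    -- The TCM read off from an extremal matrix is one of those over which `h` is the maximum.
    (ℚ.*-monoʳ-≤-nonNeg _ {{nonNegative-ℕ→ℚ^ (1 ℕ.+ k) (m ∸ 2)}} (h-max omit omit-isTCM)))
  where
  open Columns A simple avoids
  open PairSums (1 ℕ.+ k) omit using (scaledWeight)

lower : ∀ m k f h → IsForbM m (3 ℕ.+ k) f → IsH2 m (alphaR (3 ℕ.+ k)) h →
  h * ℕ→ℚ (1 ℕ.+ k) ^ℚ (m ∸ 2) ℚ.≤ ℕ→ℚ f - ℕ→ℚ (2 ℕ.+ k) ^ℚ m - ℕ→ℚ m * (ℕ→ℚ (2 ℕ.+ k) ^ℚ (m ∸ 1))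
lower m k f h (_ , f-max) ((e , tcm , rec2 , refl) , _) = ℚ.≤-trans
  (ℚ.≤-reflexive (weight-scaled k e))
  (excess-≥ m (2 ℕ.+ k) scaledWeight
    -- Conversely, the matrix built from a TCM of greatest weight is one of those over which `f` is
    -- the maximum.
    (ℕ.≤-trans columns-length (f-max (length columns) matrix matrix-simple matrix-avoids)))
  where
  open Construction (1 ℕ.+ k) e tcm rec2
  open PairSums (1 ℕ.+ k) e using (scaledWeight)

theorem1p5 : ∀ (m r : ℕ) → 3 ≤ r →
    ∀ (f : ℕ) (h h₂ : ℚ) → IsForbM m r f → IsH m (alphaR r) h → IsH2 m (alphaR r) h₂ →
      let lhs = ℕ→ℚ f - ℕ→ℚ (r ∸ 1) ^ℚ m - ℕ→ℚ m * (ℕ→ℚ (r ∸ 1) ^ℚ (m ∸ 1))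
          c = ℕ→ℚ (r ∸ 2) ^ℚ (m ∸ 2)
      in (h₂ * c Data.Rational.≤ lhs) × (lhs Data.Rational.≤ h * c)
theorem1p5 m (ℕ.suc (ℕ.suc (ℕ.suc k))) (s≤s (s≤s (s≤s _))) f h h₂ forb isH isH₂ =
  lower m k f h₂ forb isH₂ , upper m k f h forb isH
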